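{- For every perfect graph $G=(V,E)$, the Coloring Algorithm (described in the context) gives an optimal coloring of $G$, i.e., a proper coloring using exactly $\chi(G)$ colors. Moreover, during any execution of the inner loop of the Coloring Algorithm, the number of iterations of that inner loop is at most $|V|$.
   Context: All graphs are finite and simple. $\omega$, $\chi$ denote the clique number and chromatic number ($\omega$ of the graph with no vertices is $0$). A graph $G$ is perfect if $\chi(H)=\omega(H)$ for every induced subgraph $H$ of $G$. $\bar G$ denotes the complement of $G$; for a vertex set $S$, $G\setminus S$ is the induced subgraph on $V\setminus S$. A clique decision oracle is assumed which, given a perfect graph and an integer $k\ge 2$, correctly says whether the graph has a clique of size $k$; using it, $\omega$ of any perfect graph can be computed. Max-Clique Procedure. Input: a perfect graph $G=(V,E)$. Compute $\omega(G)$ using binary search and the oracle. Set $H=G$ and fix any ordering $v_1,\dots,v_{|V|}$ of $V$. For $i=1,\dots,|V|$: if $H\setminus\{v_i\}$ contains a clique of size $\omega(G)$, replace $H$ by $H\setminus\{v_i\}$. Output the vertex set of $H$ (a maximum clique of $G$). Hitting-Stable-Set Procedure. Input: a perfect graph $G=(V,E)$ and a collection $\mathcal C=\{C_1,\dots,C_m\}$ of maximum cliques of $G$. For each $v\in V$ let $w(v)=|\{i: v\in C_i\}|$. Build a graph $G'=(V',E')$ whose vertices are, for each $v\in V$, $w(v)$ copies $v^{(1)},\dots,v^{(w(v))}$ (none if $w(v)=0$), and in which, for every edge $uv\in E$, every copy of $u$ is adjacent to every copy of $v$ (there are no other edges). Let $S'$ be the output of the Max-Clique Procedure on $\overline{G'}$.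 Output $S=\{v\in V:\ v^{(j)}\in S'\text{ for some }j\}$. Coloring Algorithm. Input: a perfect graph $G=(V,E)$. Outer loop: while the current graph $G$ is not empty, do the following. Apply the Max-Clique Procedure to $G$ to get a maximum clique $C$ and set $\mathcal C=\{C\}$. Inner loop: repeat [apply the Hitting-Stable-Set Procedure to $(G,\mathcal C)$ to get a set $S$; if $\omega(G)>\omega(G\setminus S)$, exit the inner loop; otherwise apply the Max-Clique Procedure to $G\setminus S$ to get a maximum clique $C'$ of $G\setminus S$ and replace $\mathcal C$ by $\mathcal C\cup\{C'\}$]. After exiting the inner loop, color all vertices of $S$ with a new color and replace $G$ by $G\setminus S$. In the statement, $G=(V,E)$ denotes the original input graph. -}

module Defs where

open import Data.Bool using (Bool; true; if_then_else_)
import Data.Bool.Properties as Bool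
open import Data.Fin using (Fin; toℕ; combine; remQuot)
open import Data.Fin.Properties using (_≟_; any?)
open import Data.Fin.Subset
  using (Subset; _∈_; _⊆_; _∩_; ∁; ⁅_⁆; ∣_∣; Empty; Nonempty)
open import Data.Fin.Subset.Properties using (_∈?_)
open import Data.List using (List; _∷_; [_]; length; filter; foldl)
import Data.List.Membership.DecPropositional as DecMembership
import Data.List.Membership.Propositional as List
open import Data.List.Relation.Unary.Unique.Propositional using (Unique)
open import Data.Maybe using (Maybe; just; nothing; Is-just)
open import Data.Nat
  using (ℕ; zero; suc; _+_; _*_; _≤_; _<_; _<?_; _≤ᵇ_; ⌊_/2⌋)
open import Data.Product using (_×_; _,_; proj₁; proj₂; ∃-syntax; Σ-syntax)
open import Data.Vec using (tabulate)
open import Data.Vec.Properties using (≡-dec)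
open import Function using (_⇔_; flip)
open import Induction.WellFounded using (Acc)
open import Level using (0ℓ) renaming (suc to lsuc)
open import Relation.Binary using (Rel; Decidable; Symmetric)
open import Relation.Binary.Construct.Closure.ReflexiveTransitive using (Star)
open import Relation.Binary.PropositionalEquality using (_≡_; _≢_; refl; sym)
open import Relation.Nullary using (¬_; does; ¬?; _×-dec_)
import Relation.Unary as U

-- The vertex set is an arbitrary subset of the index set Fin n, so that
-- deleting vertices needs no relabelling.  Adjacency matters only between
-- members of `vertices`; its values elsewhere are never consulted.
record Graph (n : ℕ) : Set₁ where
  infix 4 _~_
  field
    vertices : Subset n
    _~_      : Rel (Fin n) 0ℓ
    _~?_     : Decidable _~_
    ~-sym    : Symmetric _~_
    ~-irrefl : ∀ {v} → ¬ (v ~ v)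

open Graph public using (vertices)

infixl 5 _↾_ _∖_

_↾_ : ∀ {n} → Graph n → Subset n → Graph n
G ↾ W = record
  { vertices = vertices G ∩ W
  ; _~_ = _~_ ; _~?_ = _~?_ ; ~-sym = ~-sym ; ~-irrefl = ~-irrefl }
  where open Graph G hiding (vertices)

_∖_ : ∀ {n} → Graph n → Subset n → Graph n
G ∖ S = G ↾ ∁ S

complement : ∀ {n} → Graph n → Graph n
complement G = record
  { vertices = vertices G
  ; _~_      = λ u v → u ≢ v × ¬ (u ~ v)
  ; _~?_     = λ u v → ¬? (u ≟ v) ×-dec ¬? (u ~? v)
  ; ~-sym    = λ (u≢v , u≁v) → (λ v≡u → u≢v (sym v≡u)) , (λ v~u → u≁v (~-sym v~u))
  ; ~-irrefl = λ (v≢v , _) → v≢v refl }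
  where open Graph G hiding (vertices)

IsClique : ∀ {n} → Graph n → Subset n → Set
IsClique G K = K ⊆ vertices G × (∀ {u v} → u ∈ K → v ∈ K → u ≢ v → u ~ v)
  where open Graph G hiding (vertices)

HasClique : ∀ {n} → Graph n → ℕ → Set
HasClique {n} G k = Σ[ K ∈ Subset n ] IsClique G K × ∣ K ∣ ≡ k

IsCliqueNumber : ∀ {n} → Graph n → ℕ → Set
IsCliqueNumber G k = HasClique G k × (∀ l → HasClique G l → l ≤ k)

-- `nothing` marks a vertex that has not been coloured.
Coloring : ℕ → Set
Coloring n = Fin n → Maybe ℕ

IsProper : ∀ {n} → Graph n → Coloring n → Set
IsProper G c =
  (∀ {v} → v ∈ vertices G → Is-just (c v)) ×
  (∀ {u v} → u ∈ vertices G → v ∈ vertices G → u ~ v → c u ≢ c v)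
  where open Graph G hiding (vertices)

UsesExactly : ∀ {n} → Graph n → Coloring n → ℕ → Set
UsesExactly {n} G c k =
  Σ[ colors ∈ List ℕ ] Unique colors × length colors ≡ k ×
    (∀ a → a List.∈ colors ⇔ (Σ[ v ∈ Fin n ] v ∈ vertices G × c v ≡ just a))

HasColoring : ∀ {n} → Graph n → ℕ → Set
HasColoring {n} G k = Σ[ c ∈ Coloring n ] IsProper G c × UsesExactly G c k

IsChromaticNumber : ∀ {n} → Graph n → ℕ → Set
IsChromaticNumber G k = HasColoring G k × (∀ l → HasColoring G l → k ≤ l)

-- W ranges over all subsets of Fin n, hence G ↾ W over exactly the induced
-- subgraphs of G.
Perfect : ∀ {n} → Graph n → Set
Perfect {n} G =
  ∀ (W : Subset n) → ∃[ k ] IsChromaticNumber (G ↾ W) k × IsCliqueNumber (G ↾ W) k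

IsOptimalColoring : ∀ {n} → Graph n → Coloring n → Set
IsOptimalColoring G c =
  IsProper G c × (∃[ k ] IsChromaticNumber G k × UsesExactly G c k)

-- Nothing is assumed about the answers on imperfect graphs or for k < 2.
record CliqueOracle : Set₁ where
  field
    query   : ∀ {n} → Graph n → ℕ → Bool
    correct : ∀ {n} (G : Graph n) (k : ℕ) → Perfect G → 2 ≤ k →
              query G k ≡ true ⇔ HasClique G k

IsOrdering : ∀ {n} → Graph n → List (Fin n) → Set
IsOrdering G vs = Unique vs × (∀ v → v List.∈ vs ⇔ v ∈ vertices G)

-- The function w v = |{i : v ∈ Cᵢ}|.
weight : ∀ {n} → List (Subset n) → Fin n → ℕ
weight 𝒞 v = length (filter (v ∈?_) 𝒞)

comprehension : ∀ {n} {P : U.Pred (Fin n) 0ℓ} → U.Decidable P → Subset n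
comprehension P? = tabulate (λ v → does (P? v))

-- Each v is replaced by w v copies, namely the `combine v j` with toℕ j < w v;
-- since w v ≤ length 𝒞, the index set Fin (n * length 𝒞) has room for them.
replicated : ∀ {n} → Graph n → (𝒞 : List (Subset n)) → Graph (n * length 𝒞)
replicated {n} G 𝒞 = record
  { vertices = comprehension λ x →
      (original x ∈? vertices G) ×-dec (toℕ (index x) <? weight 𝒞 (original x))
  ; _~_      = λ x y → original x ~ original y
  ; _~?_     = λ x y → original x ~? original y
  ; ~-sym    = ~-sym
  ; ~-irrefl = ~-irrefl }
  where
  open Graph G hiding (vertices)
  original : Fin (n * length 𝒞) → Fin n
  original x = proj₁ (remQuot {n} (length 𝒞) x)
  index : Fin (n * length 𝒞) → Fin (length 𝒞)
  index x = proj₂ (remQuot {n} (length 𝒞) x)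

originals : ∀ {n} → Graph n → (m : ℕ) → Subset (n * m) → Subset n
originals G m S′ = comprehension λ v →
  (v ∈? vertices G) ×-dec any? {n = m} (λ j → combine v j ∈? S′)

-- Searches for the largest k in [lo, hi) with p k, where p is downward
-- closed, p lo holds and p hi fails.  Fuel hi ∸ lo suffices.
binarySearch : (p : ℕ → Bool) (fuel lo hi : ℕ) → ℕ
binarySearch p zero       lo hi = lo
binarySearch p (suc fuel) lo hi =
  if hi ≤ᵇ suc lo then lo
  else if p mid then binarySearch p fuel mid hi
  else binarySearch p fuel lo mid
  where mid = ⌊ lo + hi /2⌋

insert : ∀ {n} → Subset n → List (Subset n) → List (Subset n)
insert {n} C 𝒞 = if does (C ∈ᴸ? 𝒞) then 𝒞 else C ∷ 𝒞
  where open DecMembership (≡-dec {n = n} Bool._≟_) using () renaming (_∈?_ to _∈ᴸ?_)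

paint : ∀ {n} → Subset n → ℕ → Coloring n → Coloring n
paint S a c v = if does (v ∈? S) then just a else c v

-- A state of the Coloring Algorithm.
--   outer H c      : about to test the condition of the outer loop, with
--                    current graph H and partial colouring c;
--   inner H 𝒞 i c  : about to carry out the i-th iteration (counted from 1)
--                    of the current run of the inner loop;
--   halted c       : finished with output c.
data State (n : ℕ) : Set₁ where
  outer  : Graph n → Coloring n → State n
  inner  : Graph n → List (Subset n) → ℕ → Coloring n → State n
  halted : Coloring n → State n

initial : ∀ {n} → Graph n → State n
initial G = outer G (λ _ → nothing)

module Algorithm (O : CliqueOracle) where
  open CliqueOracle O

  -- The oracle is only for k ≥ 2; cliques of size 0 and 1 are trivial.
  hasClique? : ∀ {n} → Graph n → ℕ → Bool
  hasClique? G k = if 2 ≤ᵇ k then query G k else k ≤ᵇ ∣ vertices G ∣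

  computeω : ∀ {n} → Graph n → ℕ
  computeω G = binarySearch (hasClique? G) hi 0 hi
    where hi = suc ∣ vertices G ∣

  maxClique : ∀ {n} → Graph n → List (Fin n) → Subset n
  maxClique {n} G vs = vertices (foldl step G vs)
    where
    ωG = computeω G
    step : Graph n → Fin n → Graph n
    step H v = if hasClique? (H ∖ ⁅ v ⁆) ωG then H ∖ ⁅ v ⁆ else H

  -- The procedures are relations between inputs and possible outputs, since
  -- every call may fix its own vertex ordering.
  MaxClique : ∀ {n} → Graph n → Subset n → Set
  MaxClique {n} G C = Σ[ vs ∈ List (Fin n) ] IsOrdering G vs × C ≡ maxClique G vs

  HittingStableSet : ∀ {n} → Graph n → List (Subset n) → Subset n → Set
  HittingStableSet {n} G 𝒞 S =
    Σ[ S′ ∈ Subset (n * length 𝒞) ]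
      MaxClique (complement (replicated G 𝒞)) S′ × S ≡ originals G (length 𝒞) S′

  infix 3 _⟶_ _⟶*_

  data _⟶_ {n : ℕ} : Rel (State n) (lsuc 0ℓ) where
    finish : ∀ {H c} →
      Empty (vertices H) →
      outer H c ⟶ halted c

    enter : ∀ {H c C} →
      Nonempty (vertices H) →
      MaxClique H C →
      outer H c ⟶ inner H [ C ] 1 c

    exit : ∀ {H 𝒞 i c S a} →
      HittingStableSet H 𝒞 S →
      computeω (H ∖ S) < computeω H →
      (∀ v → c v ≢ just a) →
      inner H 𝒞 i c ⟶ outer (H ∖ S) (paint S a c)

    continue : ∀ {H 𝒞 i c S C′} →
      HittingStableSet H 𝒞 S →
      ¬ (computeω (H ∖ S) < computeω H) →
      MaxClique (H ∖ S) C′ →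
      inner H 𝒞 i c ⟶ inner H (insert C′ 𝒞) (suc i) c

  _⟶*_ : ∀ {n} → Rel (State n) (lsuc 0ℓ)
  _⟶*_ = Star _⟶_

  Terminates : ∀ {n} → State n → Set₁
  Terminates s = Acc (flip _⟶_) s

{-# OPTIONS --safe #-}

-- A call of the Hitting-Stable-Set Procedure queries the oracle on the complement of the
-- replicated graph G′, so the weak perfect graph theorem is needed.  Perfection is used in
-- the weighted form "if every clique has weight at most k, then k stable sets cover the
-- weight", which follows from the unweighted one by Lovász's replication argument; applied to
-- a weight built from stable sets that miss the cliques, it yields a clique meeting all maximum
-- stable sets, and so a cover of the graph by cliques.
--
-- If 𝒞 consists of m maximum cliques, then G′ has m ω vertices and is covered by ω
-- stable sets, so the stable set S has weight at least m and meets each of the m cliques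
-- exactly once.  The next clique C′ misses S, whereas any linear combination of the members
-- of 𝒞 equal to C′ would have coefficient sum 1 by size and 0 on S.  Hence the
-- cliques collected in the inner loop are linearly independent, and there are at most |V| of them.
-- Each colour lowers ω by at least one, so at most ω = χ colours are used.
module Submission where

open import Defs
import Algebra.Properties.Semiring.Sum as Sum
open import Data.Bool using (Bool; true; false; if_then_else_; T)
import Data.Bool.Properties as Bool
open import Data.Empty as Empty using (⊥-elim)
open import Data.Fin using (Fin; zero; suc; toℕ; combine; remQuot; punchIn; _↑ˡ_; _↑ʳ_)
open import Data.Fin.Properties using (all?; any?; remQuot-combine; combine-remQuot) renaming (_≟_ to _≟ᶠ_)
open import Data.Fin.Subset hiding (_─_; _-_)
open import Data.Fin.Subset.Properties
open import Data.Integer using (ℤ; 0ℤ; 1ℤ; -_)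
  renaming (+_ to pos; _+_ to _+ᶻ_; _*_ to _*ᶻ_; _≟_ to _≟ᶻ_; _-_ to _-ᶻ_)
import Data.Integer.Properties as ℤ
open import Data.Integer.Tactic.RingSolver using (solve-∀)
open import Data.List using (List; []; _∷_; [_]; length; lookup; map; _++_; filter; foldl; upTo; allFin)
import Data.List.Membership.DecPropositional as DecMembership
import Data.List.Membership.Propositional as List
import Data.List.Membership.Propositional.Properties as List
open import Data.List.Properties using (length-map; length-filter; length-upTo)
open import Data.List.Relation.Unary.All using (All; []; _∷_)
import Data.List.Relation.Unary.All as All
import Data.List.Relation.Unary.All.Properties as All
open import Data.List.Relation.Unary.AllPairs using ([]; _∷_)
open import Data.List.Relation.Unary.Any using (Any; here; there)
import Data.List.Relation.Unary.Any.Properties as Any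
import Data.List.Relation.Unary.Unique.Propositional.Properties as Unique
open import Data.Maybe using (Maybe; just; nothing; Is-just; maybe)
import Data.Maybe.Properties as Maybe
import Data.Maybe.Relation.Unary.Any as MaybeAny
open import Data.Nat
open import Data.Nat.Properties
open import Data.Product hiding (map)
open import Data.Sum using (_⊎_; inj₁; inj₂)
open import Data.Vec using ([]; _∷_; here; there)
open import Data.Vec.Functional using (insertAt)
open import Data.Vec.Functional.Properties using (insertAt-lookup; insertAt-punchIn)
open import Data.Vec.Properties using (≡-dec)
open import Function using (_⇔_; mk⇔; Equivalence; _∘_; id; case_of_)
open import Induction.WellFounded using (acc)
open import Relation.Binary.Construct.Closure.ReflexiveTransitive using (ε; _◅_)
open import Relation.Binary.PropositionalEquality hiding ([_])
open import Relation.Binary.Rewriting using (IsNormalForm)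
open import Relation.Nullary using (¬_; Dec; yes; no; does; ¬?; _×-dec_; _→-dec_)
open import Relation.Nullary.Decidable using (dec-true; dec-false; decidable-stable; map′)

open Equivalence using (to; from)
open Sum +-*-semiring using (sum; sum-syntax; ∑-distrib-+; sum-cong-≗; sum-replicate-zero)
module ℤΣ = Sum ℤ.+-*-semiring
open ℤΣ using () renaming (sum to sumᶻ; sum-cong-≗ to sumᶻ-cong)

private variable
  n k : ℕ
  A B K W : Subset n
  G : Graph n
  L : List (Subset n)

-- Finite sums, indicator functions and weights

sum-mono : ∀ {n} {f g : Fin n → ℕ} → (∀ v → f v ≤ g v) → sum f ≤ sum g
sum-mono {zero}  f≤g = z≤n
sum-mono {suc n} f≤g = +-mono-≤ (f≤g zero) (sum-mono (f≤g ∘ suc))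

sum-mono-< : ∀ {n} {f g : Fin n → ℕ} → (∀ v → f v ≤ g v) → ∀ u → f u < g u → sum f < sum g
sum-mono-< f≤g zero    fu<gu = +-mono-<-≤ fu<gu (sum-mono (f≤g ∘ suc))
sum-mono-< f≤g (suc u) fu<gu = +-mono-≤-< (f≤g zero) (sum-mono-< (f≤g ∘ suc) u fu<gu)

infix 7 _·_

-- With `𝟙 A` on one side this is the weight of A, with indicators on both sides the size of the
-- intersection.
_·_ : (f g : Fin n → ℕ) → ℕ
f · g = sum (λ v → f v * g v)

𝟙 : Subset n → Fin n → ℕ
𝟙 A v = if does (v ∈? A) then 1 else 0

𝟙-∈ : ∀ {v} → v ∈ A → 𝟙 A v ≡ 1
𝟙-∈ {A = A} {v} v∈A rewrite dec-true (v ∈? A) v∈A = refl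

𝟙-∉ : ∀ {v} → v ∉ A → 𝟙 A v ≡ 0
𝟙-∉ {A = A} {v} v∉A rewrite dec-false (v ∈? A) v∉A = refl

𝟙≤1 : ∀ (A : Subset n) v → 𝟙 A v ≤ 1
𝟙≤1 A v with does (v ∈? A)
... | true  = ≤-refl
... | false = z≤n

𝟙-positive : ∀ {v} → 1 ≤ 𝟙 A v → v ∈ A
𝟙-positive {A = A} {v} 1≤ with v ∈? A
... | yes v∈A = v∈A

·-comm : ∀ (f g : Fin n → ℕ) → f · g ≡ g · f
·-comm f g = sum-cong-≗ (λ v → *-comm (f v) (g v))

·-distribʳ : ∀ (f g h : Fin n → ℕ) → (λ v → f v + g v) · h ≡ f · h + g · h
·-distribʳ f g h =
  trans (sum-cong-≗ (λ v → *-distribʳ-+ (h v) (f v) (g v)))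
        (∑-distrib-+ (λ v → f v * h v) (λ v → g v * h v))

𝟙*-mono : ∀ {f g : Fin n → ℕ} → (∀ {v} → v ∈ A → f v ≤ g v) → ∀ v → 𝟙 A v * f v ≤ 𝟙 A v * g v
𝟙*-mono {A = A} f≤g v with v ∈? A
... | yes v∈A = *-monoʳ-≤ 1 (f≤g v∈A)
... | no  _   = z≤n

𝟙·-mono : ∀ {f g : Fin n → ℕ} → (∀ {v} → v ∈ A → f v ≤ g v) → 𝟙 A · f ≤ 𝟙 A · g
𝟙·-mono f≤g = sum-mono (𝟙*-mono f≤g)

𝟙·-mono-< : ∀ {f g : Fin n → ℕ} {u} → (∀ {v} → v ∈ A → f v ≤ g v) →
            u ∈ A → f u < g u → 𝟙 A · f < 𝟙 A · g
𝟙·-mono-< {A = A} {f} {g} {u} f≤g u∈A fu<gu =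
  sum-mono-< (𝟙*-mono f≤g) u (subst (λ i → i * f u < i * g u) (sym (𝟙-∈ u∈A)) (*-monoʳ-< 1 fu<gu))

𝟙·𝟙 : ∀ (A B : Subset n) → 𝟙 A · 𝟙 B ≡ ∣ A ∩ B ∣
𝟙·𝟙 []            []            = refl
𝟙·𝟙 (inside  ∷ A) (inside  ∷ B) = cong suc (𝟙·𝟙 A B)
𝟙·𝟙 (inside  ∷ A) (outside ∷ B) = 𝟙·𝟙 A B
𝟙·𝟙 (outside ∷ A) (_       ∷ B) = 𝟙·𝟙 A B

weight-∷ : ∀ (A : Subset n) L v → weight (A ∷ L) v ≡ 𝟙 A v + weight L v
weight-∷ A L v with does (v ∈? A)
... | true  = refl
... | false = refl

weight-∷-· : ∀ (A : Subset n) L f → weight (A ∷ L) · f ≡ 𝟙 A · f + weight L · f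
weight-∷-· A L f =
  trans (sum-cong-≗ (λ v → cong (_* f v) (weight-∷ A L v))) (·-distribʳ (𝟙 A) (weight L) f)

-- Double counting: `weight L` is the sum of the indicators of the members, so the pairing splits
-- into one term per member.
weight-·-≤ : ∀ {f : Fin n → ℕ} → All (λ A → 𝟙 A · f ≤ k) L → weight L · f ≤ length L * k
weight-·-≤ {n = n} [] = ≤-reflexive (sum-replicate-zero n)
weight-·-≤ {L = A ∷ L} {f} (p ∷ ps) =
  subst (_≤ _) (sym (weight-∷-· A L f)) (+-mono-≤ p (weight-·-≤ ps))

weight-·-≥ : ∀ {f : Fin n → ℕ} → All (λ A → k ≤ 𝟙 A · f) L → length L * k ≤ weight L · f
weight-·-≥ [] = z≤n
weight-·-≥ {L = A ∷ L} {f} (p ∷ ps) =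
  subst (_ ≤_) (sym (weight-∷-· A L f)) (+-mono-≤ p (weight-·-≥ ps))

weight-∈ : ∀ {v} → A List.∈ L → v ∈ A → 1 ≤ weight L v
weight-∈ {A = A} {L = _ ∷ L} {v} (here refl) v∈A =
  subst (1 ≤_) (sym (trans (weight-∷ A L v) (cong (_+ _) (𝟙-∈ v∈A)))) (s≤s z≤n)
weight-∈ {L = B ∷ L} {v} (there A∈L) v∈A =
  ≤-trans (weight-∈ A∈L v∈A) (subst (_ ≤_) (sym (weight-∷ B L v)) (m≤n+m _ _))

weight-∋ : ∀ (L : List (Subset n)) {v} → 1 ≤ weight L v → ∃[ A ] A List.∈ L × v ∈ A
weight-∋ (A ∷ L) {v} 1≤ with v ∈? A
... | yes v∈A = A , here refl , v∈A
... | no  _   = let B , B∈L , v∈B = weight-∋ L 1≤ in B , there B∈L , v∈B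

-- The first member containing v is moved to the front, which changes neither the length nor the
-- weights.
weight-remove : ∀ {P : Subset n → Set} {v} → All P L → 1 ≤ weight L v →
  ∃[ A ] ∃[ L₀ ] v ∈ A × P A × All P L₀ × length L ≡ suc (length L₀) ×
    (∀ u → weight L u ≡ 𝟙 A u + weight L₀ u)
weight-remove {L = A ∷ L} {v = v} (pA ∷ pL) 1≤ with v ∈? A
... | yes v∈A = A , L , v∈A , pA , pL , refl , weight-∷ A L
... | no  _   with weight-remove pL 1≤
...   | B , L₀ , v∈B , pB , pL₀ , len , eq =
  B , A ∷ L₀ , v∈B , pB , pA ∷ pL₀ , cong suc len , λ u → begin
    weight (A ∷ L) u                 ≡⟨ weight-∷ A L u ⟩
    𝟙 A u + weight L u               ≡⟨ cong (𝟙 A u +_) (eq u) ⟩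
    𝟙 A u + (𝟙 B u + weight L₀ u)    ≡⟨ +-assoc (𝟙 A u) _ _ ⟨
    𝟙 A u + 𝟙 B u + weight L₀ u      ≡⟨ cong (_+ weight L₀ u) (+-comm (𝟙 A u) _) ⟩
    𝟙 B u + 𝟙 A u + weight L₀ u      ≡⟨ +-assoc (𝟙 B u) _ _ ⟩
    𝟙 B u + (𝟙 A u + weight L₀ u)    ≡⟨ cong (𝟙 B u +_) (weight-∷ A L₀ u) ⟨
    𝟙 B u + weight (A ∷ L₀) u        ∎
  where open ≡-Reasoning

-- The weak perfect graph theorem

Stable : Graph n → Subset n → Set
Stable G = IsClique (complement G)

∣∣≤1 : {A : Subset n} → (∀ {u v} → u ∈ A → v ∈ A → u ≡ v) → ∣ A ∣ ≤ 1
∣∣≤1 {n} {A} unique with nonempty? A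
... | yes (u , u∈A) = subst (∣ A ∣ ≤_) (∣⁅x⁆∣≡1 u)
        (p⊆q⇒∣p∣≤∣q∣ λ v∈A → subst (_∈ ⁅ u ⁆) (unique u∈A v∈A) (x∈⁅x⁆ u))
... | no empty = subst (λ X → ∣ X ∣ ≤ 1) (sym (Empty-unique empty))
        (≤-trans (≤-reflexive (∣⊥∣≡0 n)) z≤n)

stable-clique : Stable G A → IsClique G K → ∣ A ∩ K ∣ ≤ 1
stable-clique {A = A} {K} (_ , sA) (_ , cK) = ∣∣≤1 λ {u} {v} u∈ v∈ →
  case u ≟ᶠ v of λ where
    (yes u≡v) → u≡v
    (no u≢v) → let u∈A , u∈K = x∈p∩q⁻ A K u∈ ; v∈A , v∈K = x∈p∩q⁻ A K v∈ in
      ⊥-elim (proj₂ (sA u∈A v∈A u≢v) (cK u∈K v∈K u≢v))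

clique-mono : A ⊆ B → IsClique G B → IsClique G A
clique-mono A⊆B (B⊆V , cB) = (B⊆V ∘ A⊆B) , λ u∈A v∈A → cB (A⊆B u∈A) (A⊆B v∈A)

⊥-clique : (G : Graph n) → IsClique G ⊥
⊥-clique G = ⊥-elim ∘ ∉⊥ , λ u∈⊥ → ⊥-elim (∉⊥ u∈⊥)

⁅⁆-clique : ∀ {v} (G : Graph n) → v ∈ vertices G → IsClique G ⁅ v ⁆
⁅⁆-clique {v = v} G v∈V =
  (λ u∈ → subst (_∈ vertices G) (sym (x∈⁅y⁆⇒x≡y v u∈)) v∈V) ,
  λ u∈ w∈ u≢w → ⊥-elim (u≢w (trans (x∈⁅y⁆⇒x≡y v u∈) (sym (x∈⁅y⁆⇒x≡y v w∈))))

isClique? : (G : Graph n) (K : Subset n) → Dec (IsClique G K)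
isClique? G K = (K ⊆? vertices G) ×-dec map′ (λ f {u} {v} → f u v) (λ f u v → f)
    (all? λ u → all? λ v → (u ∈? K) →-dec (v ∈? K) →-dec ¬? (u ≟ᶠ v) →-dec (u ~? v))
  where open Graph G using (_~?_)

stable-complement : IsClique G K → Stable (complement G) K
stable-complement (K⊆V , cK) = K⊆V , λ u∈K v∈K u≢v → u≢v , λ (_ , u≁v) → u≁v (cK u∈K v∈K u≢v)

Bounded : Graph n → (Fin n → ℕ) → ℕ → Set
Bounded G w k = ∀ {K} → IsClique G K → 𝟙 K · w ≤ k

Colorable : Graph n → (Fin n → ℕ) → ℕ → Set
Colorable G w k =
  ∃[ L ] All (Stable G) L × length L ≤ k × (∀ {v} → v ∈ vertices G → w v ≤ weight L v)

-- The inequality χ ≤ ω with weights. For `w = 𝟙 W` it speaks of the subgraph induced by W; in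
-- general, of the graph in which each v is blown up to a clique of `w v` copies.
PerfectFor : Graph n → (Fin n → ℕ) → Set
PerfectFor G w = ∀ k → Bounded G w k → Colorable G w k

bounded⊎exceeded : (G : Graph n) (w : Fin n → ℕ) (k : ℕ) →
  Bounded G w k ⊎ ∃[ K ] IsClique G K × k < 𝟙 K · w
bounded⊎exceeded G w k with anySubset? (λ K → isClique? G K ×-dec (k <? 𝟙 K · w))
... | yes big = inj₂ big
... | no ¬big = inj₁ λ cK → ≮⇒≥ λ k< → ¬big (_ , cK , k<)

-- The total weight bounds every clique; lowering it one at a time as long as it stays a bound stops
-- at the weight of a heaviest clique.
bounded-attained : (G : Graph n) (w : Fin n → ℕ) →
  ∃[ k ] Bounded G w k × ∃[ K ] IsClique G K × k ≤ 𝟙 K · w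
bounded-attained G w = descend (sum w) λ {K} _ → sum-mono λ v →
    ≤-trans (*-monoˡ-≤ (w v) (𝟙≤1 K v)) (≤-reflexive (*-identityˡ (w v)))
  where
  descend : ∀ k → Bounded G w k → ∃[ k ] Bounded G w k × ∃[ K ] IsClique G K × k ≤ 𝟙 K · w
  descend zero    bound = 0 , bound , ⊥ , ⊥-clique G , z≤n
  descend (suc k) bound with bounded⊎exceeded G w k
  ... | inj₁ bound′         = descend k bound′
  ... | inj₂ (K , cK , big) = suc k , bound , K , cK , big

∈-comprehension⁺ : ∀ {P : Fin n → Set} (P? : ∀ v → Dec (P v)) {v} → P v → v ∈ comprehension P?
∈-comprehension⁺ {suc n} P? {zero} p with P? zero
... | yes _ = here
... | no ¬p = ⊥-elim (¬p p)
∈-comprehension⁺ {suc n} P? {suc v} p = there (∈-comprehension⁺ (P? ∘ suc) p)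

∈-comprehension⁻ : ∀ {P : Fin n → Set} (P? : ∀ v → Dec (P v)) {v} → v ∈ comprehension P? → P v
∈-comprehension⁻ {suc n} P? {zero} v∈ with P? zero
... | yes p = p
∈-comprehension⁻ {suc n} P? {suc v} (there v∈) = ∈-comprehension⁻ (P? ∘ suc) v∈

infixl 6 _⊖_

_⊖_ : (Fin n → ℕ) → Subset n → Fin n → ℕ
(w ⊖ A) v = w v ∸ 𝟙 A v

⊖-≤ : ∀ (w : Fin n → ℕ) A v → (w ⊖ A) v ≤ w v
⊖-≤ w A v = m∸n≤m (w v) (𝟙 A v)

⊖-< : ∀ (w : Fin n → ℕ) {v} → v ∈ A → 1 ≤ w v → (w ⊖ A) v < w v
⊖-< w {v} v∈A 1≤wv = subst (λ i → w v ∸ i < w v) (sym (𝟙-∈ v∈A)) (∸-monoʳ-< {o = 0} (s≤s z≤n) 1≤wv)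

-- The step of Lovász's replication lemma.  If A is a colour class through v in a colouring
-- with k colours for the weight w − 𝟙 ⁅ v ⁆, then w − 𝟙 A is bounded by k − 1: a clique through
-- v loses the vertex v, and one avoiding v is covered by the k − 1 other classes.
replication-step : ∀ {w : Fin n → ℕ} {v} → v ∈ vertices G → 2 ≤ w v → Bounded G w k →
  Colorable G (w ⊖ ⁅ v ⁆) k → (∀ {A} → v ∈ A → PerfectFor G (w ⊖ A)) → Colorable G w k
replication-step {k = k} {w} {v} v∈V 2≤wv bound (L , stable , len , cover) smaller
  -- As `2 ≤ w v`, the vertex v keeps positive weight after losing one unit, so some class contains
  -- it.
  with weight-remove {v = v} stable (≤-trans
         (subst (λ i → 1 ≤ w v ∸ i) (sym (𝟙-∈ (x∈⁅x⁆ v))) (∸-monoˡ-≤ 1 2≤wv)) (cover v∈V))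
... | A , L₀ , v∈A , sA , sL₀ , len₀ , split with subst (_≤ k) len₀ len
-- The class found makes `length L` positive, so the bound is a successor; from here on `k` is its
-- predecessor.
replication-step {G = G} {w = w} {v} v∈V 2≤wv bound (L , stable , len , cover) smaller
    | A , L₀ , v∈A , sA , sL₀ , len₀ , split | s≤s {n = k} L₀≤k
  = let L₁ , sL₁ , L₁≤k , cover₁ = smaller v∈A k bound₁ in
    A ∷ L₁ , sA ∷ sL₁ , s≤s L₁≤k , λ {u} u∈V → begin
      w u                     ≤⟨ m≤n+m∸n (w u) (𝟙 A u) ⟩
      𝟙 A u + (w ⊖ A) u       ≤⟨ +-monoʳ-≤ (𝟙 A u) (cover₁ u∈V) ⟩
      𝟙 A u + weight L₁ u     ≡⟨ weight-∷ A L₁ u ⟨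
      weight (A ∷ L₁) u       ∎
  where
  open ≤-Reasoning
  bound₁ : Bounded G (w ⊖ A) k
  bound₁ {K} cK with v ∈? K
  ... | yes v∈K = s≤s⁻¹ (≤-trans
          (𝟙·-mono-< {A = K} (λ {u} _ → ⊖-≤ w A u) v∈K (⊖-< w v∈A (≤-trans (s≤s z≤n) 2≤wv)))
          (bound cK))
  ... | no  v∉K = begin
    𝟙 K · (w ⊖ A)      ≤⟨ 𝟙·-mono {A = K} rest ⟩
    𝟙 K · weight L₀    ≡⟨ ·-comm (𝟙 K) (weight L₀) ⟩
    weight L₀ · 𝟙 K    ≤⟨ weight-·-≤ {f = 𝟙 K} (All.map (λ {B} sB →
                            ≤-trans (≤-reflexive (𝟙·𝟙 B K)) (stable-clique {G = G} sB cK)) sL₀) ⟩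
    length L₀ * 1      ≡⟨ *-identityʳ _ ⟩
    length L₀          ≤⟨ L₀≤k ⟩
    k                  ∎
    where
    rest : ∀ {u} → u ∈ K → (w ⊖ A) u ≤ weight L₀ u
    rest {u} u∈K = m≤n+o⇒m∸n≤o (w u) (𝟙 A u) (begin
      w u                    ≡⟨ cong (w u ∸_) (𝟙-∉ λ u∈v → v∉K (subst (_∈ K) (x∈⁅y⁆⇒x≡y v u∈v) u∈K)) ⟨
      (w ⊖ ⁅ v ⁆) u          ≤⟨ cover (proj₁ cK u∈K) ⟩
      weight L u             ≡⟨ split u ⟩
      𝟙 A u + weight L₀ u    ∎)

-- Induction on the total weight. A vertex of weight at least 2 is handled by the replication step;
-- without one, w agrees on the vertices with the indicator of its support.
perfectFor-weights : (∀ W → PerfectFor G (𝟙 W)) → ∀ w → PerfectFor G w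
perfectFor-weights {n} {G} perf w = go (suc (sum w)) w ≤-refl
  where
  V = vertices G
  go : ∀ fuel w → sum w < fuel → PerfectFor G w
  go (suc fuel) w (s≤s sum≤) k bound with any? (λ v → (v ∈? V) ×-dec (2 ≤? w v))
  ... | yes (v , v∈V , 2≤wv) =
    replication-step {G = G} {w = w} v∈V 2≤wv bound
      (smaller (x∈⁅x⁆ v) k λ {K} cK → ≤-trans (𝟙·-mono {A = K} λ {u} _ → ⊖-≤ w ⁅ v ⁆ u) (bound cK))
      smaller
    where
    smaller : ∀ {A} → v ∈ A → PerfectFor G (w ⊖ A)
    smaller {A} v∈A = go fuel (w ⊖ A)
      (<-≤-trans (sum-mono-< (⊖-≤ w A) v (⊖-< w v∈A (≤-trans (s≤s z≤n) 2≤wv))) sum≤)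
  ... | no ¬2≤w =
    let L , stable , len , cover = perf supp k λ {K} cK →
          ≤-trans (𝟙·-mono {A = K} λ {v} _ → 𝟙S≤w v) (bound cK)
    in  L , stable , len , λ v∈V → ≤-trans (w≤𝟙S v∈V) (cover v∈V)
    where
    positive? : ∀ v → Dec (1 ≤ w v)
    positive? v = 1 ≤? w v
    supp = comprehension positive?
    𝟙S≤w : ∀ v → 𝟙 supp v ≤ w v
    𝟙S≤w v with v ∈? supp
    ... | yes v∈S = ∈-comprehension⁻ positive? v∈S
    ... | no  v∉S = z≤n
    w≤𝟙S : ∀ {v} → v ∈ V → w v ≤ 𝟙 supp v
    w≤𝟙S {v} v∈V with 1 ≤? w v
    ... | yes 1≤w = ≤-trans (≮⇒≥ λ 2≤w → ¬2≤w (v , v∈V , 2≤w))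
                            (≤-reflexive (sym (𝟙-∈ (∈-comprehension⁺ positive? 1≤w))))
    ... | no  1≰w = ≤-trans (≮⇒≥ 1≰w) z≤n

weight-·-< : ∀ {f : Fin n → ℕ} → All (λ A → 𝟙 A · f ≤ 1) L → Any (λ A → 𝟙 A · f ≤ 0) L →
  weight L · f < length L
weight-·-< {L = A ∷ L} {f} (_ ∷ ps) (here p) =
  subst (_< suc (length L)) (sym (weight-∷-· A L f))
    (s≤s (+-mono-≤ p (≤-trans (weight-·-≤ {f = f} ps) (≤-reflexive (*-identityʳ _)))))
weight-·-< {L = A ∷ L} {f} (p ∷ ps) (there q) =
  subst (_< suc (length L)) (sym (weight-∷-· A L f)) (+-mono-≤-< p (weight-·-< ps q))

𝟙-mono : A ⊆ B → ∀ v → 𝟙 A v ≤ 𝟙 B v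
𝟙-mono {A = A} A⊆B v with v ∈? A
... | yes v∈A = ≤-reflexive (sym (𝟙-∈ (A⊆B v∈A)))
... | no  _   = z≤n

∈⇒1≤∣∣ : ∀ {v} → v ∈ A → 1 ≤ ∣ A ∣
∈⇒1≤∣∣ {A = A} {v} v∈A = subst (_≤ ∣ A ∣) (∣⁅x⁆∣≡1 v)
  (p⊆q⇒∣p∣≤∣q∣ λ u∈v → subst (_∈ A) (sym (x∈⁅y⁆⇒x≡y v u∈v)) v∈A)

allSubsets : ∀ n → List (Subset n)
allSubsets zero    = [ [] ]
allSubsets (suc n) = map (inside ∷_) (allSubsets n) ++ map (outside ∷_) (allSubsets n)

∈-allSubsets : ∀ (A : Subset n) → A List.∈ allSubsets n
∈-allSubsets []            = here refl
∈-allSubsets (inside  ∷ A) = List.∈-++⁺ˡ (List.∈-map⁺ _ (∈-allSubsets A))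
∈-allSubsets (outside ∷ A) = List.∈-++⁺ʳ (map (inside ∷_) _) (List.∈-map⁺ _ (∈-allSubsets A))

bounded? : (G : Graph n) (w : Fin n → ℕ) (k : ℕ) → Dec (Bounded G w k)
bounded? G w k with bounded⊎exceeded G w k
... | inj₁ bound          = yes bound
... | inj₂ (K , cK , big) = no λ bound → <⇒≱ big (bound cK)

-- If there were no such K, every clique K would be missed by a stable set of size suc k in W.
-- Choose one for each of the N subsets K and weigh each vertex by the number of chosen sets
-- containing it: every clique then weighs less than N, but the total weight N (suc k) is
-- too much for N − 1 stable sets.
hitting-clique : (∀ W → PerfectFor G (𝟙 W)) → ∀ {W k} → Bounded (complement G) (𝟙 W) (suc k) →
  ∃[ K ] IsClique G K × Bounded (complement G) (𝟙 (W ∩ ∁ K)) k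
hitting-clique {n} {G} perf {W} {k} bound
  with anySubset? (λ K → isClique? G K ×-dec bounded? (complement G) (𝟙 (W ∩ ∁ K)) k)
... | yes hit = hit
... | no ¬hit = let L , stable , len , cover = perfectFor-weights {G = G} perf (weight ℒ) N′ few in
  ⊥-elim (<-irrefl refl (subst (_≤ N′) N≡1+N′ (*-cancelʳ-≤ N N′ (suc k) (begin
    N * suc k             ≤⟨ weight-·-≥ {f = 𝟙 U} (All.map⁺ (All.universal large (allSubsets n))) ⟩
    weight ℒ · 𝟙 U        ≡⟨ ·-comm (weight ℒ) (𝟙 U) ⟩
    𝟙 U · weight ℒ        ≤⟨ 𝟙·-mono {A = U} (λ v∈U → cover (p∩q⊆p _ W v∈U)) ⟩
    𝟙 U · weight L        ≡⟨ ·-comm (𝟙 U) (weight L) ⟩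
    weight L · 𝟙 U        ≤⟨ weight-·-≤ {f = 𝟙 U} (All.map small stable) ⟩
    length L * suc k      ≤⟨ *-monoˡ-≤ (suc k) len ⟩
    N′ * suc k            ∎))))
  where
  open ≤-Reasoning
  V = vertices G
  U = V ∩ W
  missing-clique : ∀ K → IsClique G K →
    ∃[ A ] Stable G A × A ⊆ W × suc k ≤ ∣ A ∣ × (∀ {v} → v ∈ A → v ∉ K)
  missing-clique K cK with bounded⊎exceeded (complement G) (𝟙 (W ∩ ∁ K)) k
  ... | inj₁ b = ⊥-elim (¬hit (K , cK , b))
  ... | inj₂ (A , sA , big) =
    A ∩ (W ∩ ∁ K) ,
    clique-mono {G = complement G} (p∩q⊆p A _) sA ,
    (λ v∈ → p∩q⊆p W _ (p∩q⊆q A _ v∈)) ,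
    subst (suc k ≤_) (𝟙·𝟙 A _) big ,
    λ v∈ → x∈∁p⇒x∉p (p∩q⊆q W _ (p∩q⊆q A _ v∈))
  missing : ∀ K →
    ∃[ A ] Stable G A × A ⊆ W × suc k ≤ ∣ A ∣ × (IsClique G K → ∀ {v} → v ∈ A → v ∉ K)
  missing K with isClique? G K
  ... | yes cK = let A , sA , A⊆W , big , avoids = missing-clique K cK in
                 A , sA , A⊆W , big , λ _ → avoids
  -- A subset that is not a clique gets the set chosen for the empty clique, a filler that keeps the
  -- family indexed by all subsets.
  ... | no ¬cK = let A , sA , A⊆W , big , _ = missing-clique ⊥ (⊥-clique G) in
                 A , sA , A⊆W , big , λ cK → ⊥-elim (¬cK cK)
  ℒ = map (proj₁ ∘ missing) (allSubsets n)
  N = length ℒ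
  N′ = pred N
  N≡1+N′ : N ≡ suc N′
  N≡1+N′ = sym (suc-pred N
    {{>-nonZero (List.∈-length (List.∈-map⁺ (proj₁ ∘ missing) (∈-allSubsets {n} ⊥)))}})
  large : ∀ K → suc k ≤ 𝟙 (proj₁ (missing K)) · 𝟙 U
  large K = let A , sA , A⊆W , big , _ = missing K in begin
    suc k        ≤⟨ big ⟩
    ∣ A ∣        ≤⟨ p⊆q⇒∣p∣≤∣q∣ (λ v∈A → x∈p∩q⁺ (v∈A , x∈p∩q⁺ (proj₁ sA v∈A , A⊆W v∈A))) ⟩
    ∣ A ∩ U ∣    ≡⟨ 𝟙·𝟙 A U ⟨
    𝟙 A · 𝟙 U    ∎
  small : ∀ {A} → Stable G A → 𝟙 A · 𝟙 U ≤ suc k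
  small {A} sA = ≤-trans (𝟙·-mono {A = A} λ {v} _ → 𝟙-mono (p∩q⊆q V W) v) (bound sA)
  few : Bounded G (weight ℒ) N′
  few {K} cK = s≤s⁻¹ (begin-strict
    𝟙 K · weight ℒ    ≡⟨ ·-comm (𝟙 K) (weight ℒ) ⟩
    weight ℒ · 𝟙 K    <⟨ weight-·-< {f = 𝟙 K}
        (All.map⁺ (All.universal meets≤1 (allSubsets n)))
        (Any.map⁺ (List.lose (∈-allSubsets K) missed)) ⟩
    N                 ≡⟨ N≡1+N′ ⟩
    suc N′            ∎)
    where
    meets≤1 : ∀ J → 𝟙 (proj₁ (missing J)) · 𝟙 K ≤ 1
    meets≤1 J = let A , sA , _ = missing J in
      ≤-trans (≤-reflexive (𝟙·𝟙 A K)) (stable-clique {G = G} sA cK)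
    missed : 𝟙 (proj₁ (missing K)) · 𝟙 K ≤ 0
    missed = let A , _ , _ , _ , avoids = missing K in
      ≤-trans (≤-reflexive (𝟙·𝟙 A K)) (≤-reflexive (trans
        (cong ∣_∣ (Empty-unique λ (v , v∈) → avoids cK (p∩q⊆p A K v∈) (p∩q⊆q A K v∈))) (∣⊥∣≡0 n)))

-- Induction on the bound. The clique from `hitting-clique` meets every stable set attaining the
-- bound in W, so removing it lowers the bound by one; the removed cliques are the colour classes of
-- the complement.
perfectFor-complement : (∀ W → PerfectFor G (𝟙 W)) → ∀ W → PerfectFor (complement G) (𝟙 W)
perfectFor-complement {G = G} perf W zero bound = [] , [] , z≤n , λ {v} v∈V →
  case v ∈? W of λ where
    (no v∉W)  → ≤-reflexive (𝟙-∉ v∉W)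
    (yes v∈W) → ⊥-elim (n≮0 (≤-trans (∈⇒1≤∣∣ (x∈p∩q⁺ (x∈⁅x⁆ v , v∈W)))
      (≤-trans (≤-reflexive (sym (𝟙·𝟙 ⁅ v ⁆ W))) (bound (⁅⁆-clique (complement G) v∈V)))))
perfectFor-complement {G = G} perf W (suc k) bound =
  let K , cK , bound′ = hitting-clique {G = G} perf bound
      L , stable , len , cover = perfectFor-complement {G = G} perf (W ∩ ∁ K) k bound′
  in K ∷ L , stable-complement {G = G} cK ∷ stable , s≤s len , λ {v} v∈V → begin
    𝟙 W v                      ≤⟨ split K v ⟩
    𝟙 K v + 𝟙 (W ∩ ∁ K) v      ≤⟨ +-monoʳ-≤ (𝟙 K v) (cover v∈V) ⟩
    𝟙 K v + weight L v         ≡⟨ weight-∷ K L v ⟨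
    weight (K ∷ L) v           ∎
  where
  open ≤-Reasoning
  split : ∀ K v → 𝟙 W v ≤ 𝟙 K v + 𝟙 (W ∩ ∁ K) v
  split K v with v ∈? W | v ∈? K
  ... | no _    | _       = z≤n
  ... | yes _   | yes _   = s≤s z≤n
  ... | yes v∈W | no v∉K  = ≤-reflexive (sym (𝟙-∈ (x∈p∩q⁺ (v∈W , x∉p⇒x∈∁p v∉K))))

-- Passing between perfection and its weighted form

infix 5 _on_

-- Replacing the vertex set outright makes `(G on X) ∖ S` equal to `G on (X ∩ ∁ S)` by definition,
-- so every current graph of a run has the form `G on X`.
_on_ : Graph n → Subset n → Graph n
G on X = record { vertices = X ; _~_ = _~_ ; _~?_ = _~?_ ; ~-sym = ~-sym ; ~-irrefl = ~-irrefl }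
  where open Graph G hiding (vertices)

clique-↾ : IsClique G K → IsClique (G ↾ W) (K ∩ W)
clique-↾ {K = K} {W} (K⊆V , cK) =
  (λ v∈ → let v∈K , v∈W = x∈p∩q⁻ K W v∈ in x∈p∩q⁺ (K⊆V v∈K , v∈W)) ,
  λ u∈ v∈ → cK (p∩q⊆p K W u∈) (p∩q⊆p K W v∈)

stable-⊆ : ∀ {X Y} → X ⊆ Y → Stable (G on X) A → Stable (G on Y) A
stable-⊆ X⊆Y (A⊆X , sA) = X⊆Y ∘ A⊆X , sA

stable⇒≁ : ∀ {u v} → Stable G A → u ∈ A → v ∈ A → ¬ Graph._~_ G u v
stable⇒≁ {G = G} {u = u} {v} (_ , sA) u∈A v∈A u~v = case u ≟ᶠ v of λ where
  (yes refl) → Graph.~-irrefl G u~v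
  (no u≢v)   → proj₂ (sA u∈A v∈A u≢v) u~v

coloring⇒classes : HasColoring G k →
  ∃[ L ] All (Stable G) L × length L ≡ k × (∀ {v} → v ∈ vertices G → 1 ≤ weight L v)
coloring⇒classes {n} {G} (c , (coloured , proper) , colors , _ , len , uses) =
  map class colors , All.map⁺ (All.universal class-stable colors) , trans (length-map class colors) len , covers
  where
  inClass? : ∀ a v → Dec (v ∈ vertices G × c v ≡ just a)
  inClass? a v = (v ∈? vertices G) ×-dec Maybe.≡-dec _≟_ (c v) (just a)
  class : ℕ → Subset n
  class a = comprehension (inClass? a)
  class-stable : ∀ a → Stable G (class a)
  class-stable a = proj₁ ∘ ∈-comprehension⁻ (inClass? a) , λ u∈ v∈ u≢v →
    let u∈V , cu≡a = ∈-comprehension⁻ (inClass? a) u∈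
        v∈V , cv≡a = ∈-comprehension⁻ (inClass? a) v∈
    in u≢v , λ u~v → proper u∈V v∈V u~v (trans cu≡a (sym cv≡a))
  covers : ∀ {v} → v ∈ vertices G → 1 ≤ weight (map class colors) v
  covers {v} v∈V with c v in eq | coloured v∈V
  ... | just a | _ = weight-∈ (List.∈-map⁺ class (from (uses a) (v , v∈V , eq)))
                              (∈-comprehension⁺ (inClass? a) (v∈V , eq))

-- A stable set contains at most one vertex of K, so each vertex of K costs a set of its own.
clique≤cover : IsClique G K → All (Stable G) L → (∀ {v} → v ∈ K → 1 ≤ weight L v) → ∣ K ∣ ≤ length L
clique≤cover {G = G} {K} {L} cK stable covers = begin
  ∣ K ∣             ≤⟨ p⊆q⇒∣p∣≤∣q∣ {p = K} (λ v∈K → x∈p∩q⁺ (v∈K , v∈K)) ⟩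
  ∣ K ∩ K ∣         ≡⟨ 𝟙·𝟙 K K ⟨
  𝟙 K · 𝟙 K         ≤⟨ 𝟙·-mono {A = K} (λ {v} v∈K → ≤-trans (𝟙≤1 K v) (covers v∈K)) ⟩
  𝟙 K · weight L    ≡⟨ ·-comm (𝟙 K) (weight L) ⟩
  weight L · 𝟙 K    ≤⟨ weight-·-≤ {f = 𝟙 K} (All.map (λ {A} sA →
                          ≤-trans (≤-reflexive (𝟙·𝟙 A K)) (stable-clique {G = G} sA cK)) stable) ⟩
  length L * 1      ≡⟨ *-identityʳ _ ⟩
  length L          ∎
  where open ≤-Reasoning

clique≤coloring : IsClique G K → HasColoring G k → ∣ K ∣ ≤ k
clique≤coloring {G = G} cK coloring =
  let L , stable , len , covers = coloring⇒classes {G = G} coloring in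
  subst (_ ≤_) len (clique≤cover {G = G} cK stable (covers ∘ proj₁ cK))

-- An optimal colouring of `G ↾ W` has as many classes as a largest clique K has vertices, and K is
-- a clique of G of weight `∣ K ∣` under `𝟙 W`.
perfect⇒perfectFor : Perfect G → ∀ W → PerfectFor G (𝟙 W)
perfect⇒perfectFor {G = G} perf W k bound
  with k₀ , (coloring , _) , ((K , cK , ∣K∣≡k₀) , _) ← perf W
  with L , stable , len , covers ← coloring⇒classes {G = G ↾ W} coloring =
  L , All.map (stable-⊆ {G = G} (p∩q⊆p _ W)) stable , (begin
    length L      ≡⟨ trans len (sym ∣K∣≡k₀) ⟩
    ∣ K ∣         ≤⟨ p⊆q⇒∣p∣≤∣q∣ (λ v∈K → x∈p∩q⁺ (v∈K , p∩q⊆q _ W (proj₁ cK v∈K))) ⟩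
    ∣ K ∩ W ∣     ≡⟨ 𝟙·𝟙 K W ⟨
    𝟙 K · 𝟙 W     ≤⟨ bound (p∩q⊆p _ W ∘ proj₁ cK , proj₂ cK) ⟩
    k             ∎) ,
  λ {v} v∈V → case v ∈? W of λ where
    (yes v∈W) → ≤-trans (𝟙≤1 W v) (covers (x∈p∩q⁺ (v∈V , v∈W)))
    (no v∉W)  → ≤-trans (≤-reflexive (𝟙-∉ v∉W)) z≤n
  where open ≤-Reasoning

paint-∈ : ∀ {a v} (c : Coloring n) → v ∈ A → paint A a c v ≡ just a
paint-∈ {A = A} {v = v} _ v∈A rewrite dec-true (v ∈? A) v∈A = refl

paint-∉ : ∀ {a v} (c : Coloring n) → v ∉ A → paint A a c v ≡ c v
paint-∉ {A = A} {v = v} _ v∉A rewrite dec-false (v ∈? A) v∉A = refl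

-- Numbering from the end gives the head a number above all those used by the tail; overlaps are
-- settled in favour of the earlier member.
colour : List (Subset n) → Coloring n
colour []      = λ _ → nothing
colour (A ∷ L) = paint A (length L) (colour L)

colour-< : ∀ (L : List (Subset n)) {v a} → colour L v ≡ just a → a < length L
colour-< (A ∷ L) {v} eq with v ∈? A
colour-< (A ∷ L) refl | yes _ = ≤-refl
... | no  _ = m<n⇒m<1+n (colour-< L eq)

colour-defined : ∀ (L : List (Subset n)) {v} → 1 ≤ weight L v → Is-just (colour L v)
colour-defined (A ∷ L) {v} 1≤ with v ∈? A
... | yes _ = MaybeAny.just _
... | no  _ = colour-defined L 1≤

colour-proper : ∀ {u v a} → All (Stable G) L → Graph._~_ G u v →
  colour L u ≡ just a → colour L v ≡ just a → Empty.⊥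
colour-proper {G = G} {L = A ∷ L} {u} {v} (sA ∷ stable) u~v eq₁ eq₂ with u ∈? A | v ∈? A
... | yes u∈A | yes v∈A = stable⇒≁ {G = G} sA u∈A v∈A u~v
... | no  _   | no  _   = colour-proper {G = G} stable u~v eq₁ eq₂
colour-proper {L = A ∷ L} _ _ refl eq₂ | yes _ | no _ = <-irrefl refl (colour-< L eq₂)
colour-proper {L = A ∷ L} _ _ eq₁ refl | no _ | yes _ = <-irrefl refl (colour-< L eq₁)

Is-just⇒≡ : ∀ {A : Set} {x : Maybe A} → Is-just x → ∃[ a ] x ≡ just a
Is-just⇒≡ {x = just a} _ = a , refl

-- Only numbers that occur are listed as colours: a member hidden behind earlier ones contributes
-- none, so k may fall short of `length L`.
cover⇒coloring : All (Stable G) L → (∀ {v} → v ∈ vertices G → 1 ≤ weight L v) →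
  ∃[ k ] HasColoring G k × k ≤ length L
cover⇒coloring {n} {G} {L} stable covers =
  length colors , (colour L ,
    ((λ v∈V → colour-defined L (covers v∈V)) ,
     λ u∈V v∈V u~v cu≡cv → let a , cu≡a = Is-just⇒≡ (colour-defined L (covers u∈V)) in
       colour-proper {G = G} stable u~v cu≡a (trans (sym cu≡cv) cu≡a)) ,
    colors , Unique.filter⁺ used? (Unique.upTo⁺ (length L)) , refl ,
    λ a → mk⇔ (proj₂ ∘ List.∈-filter⁻ used? {xs = upTo (length L)})
              λ used → List.∈-filter⁺ used? (List.∈-upTo⁺ (colour-< L (proj₂ (proj₂ used)))) used) ,
  ≤-trans (length-filter used? (upTo (length L))) (≤-reflexive (length-upTo (length L)))
  where
  Used : ℕ → Set
  Used a = Σ[ v ∈ Fin n ] v ∈ vertices G × colour L v ≡ just a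
  used? : ∀ a → Dec (Used a)
  used? a = any? λ v → (v ∈? vertices G) ×-dec Maybe.≡-dec _≟_ (colour L v) (just a)
  colors = filter used? (upTo (length L))

-- Let K be a clique of largest weight k under `𝟙 W`. At most k stable sets, cut down to W, colour
-- `G ↾ W`, while the clique `K ∩ W` of size k forces at least k colours.
perfectFor⇒perfect : (∀ W → PerfectFor G (𝟙 W)) → Perfect G
perfectFor⇒perfect {n} {G} perf W
  with k , bound , K , cK , k≤ ← bounded-attained G (𝟙 W)
  with L , stable , len , covers ← perf W k bound =
  k , (subst (HasColoring (G ↾ W)) k′≡k coloring ,
       λ l c → subst (_≤ l) ∣K∩W∣≡k (clique≤coloring {G = G ↾ W} cK∩W c)) ,
  (K ∩ W , cK∩W , ∣K∩W∣≡k) ,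
  λ where _ (J , (J⊆ , cJ) , refl) → ≤-trans
            (p⊆q⇒∣p∣≤∣q∣ λ v∈J → x∈p∩q⁺ (v∈J , p∩q⊆q _ W (J⊆ v∈J)))
            (≤-trans (≤-reflexive (sym (𝟙·𝟙 J W))) (bound (p∩q⊆p _ W ∘ J⊆ , cJ)))
  where
  cK∩W : IsClique (G ↾ W) (K ∩ W)
  cK∩W = clique-↾ {G = G} cK
  ∣K∩W∣≡k : ∣ K ∩ W ∣ ≡ k
  ∣K∩W∣≡k = trans (sym (𝟙·𝟙 K W)) (≤-antisym (bound cK) k≤)
  restricted : All (Stable (G ↾ W)) (map (_∩ W) L)
  restricted = All.map⁺ (All.map (clique-↾ {G = complement G}) stable)
  restricted-covers : ∀ {v} → v ∈ vertices (G ↾ W) → 1 ≤ weight (map (_∩ W) L) v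
  restricted-covers {v} v∈ =
    let v∈V , v∈W = x∈p∩q⁻ _ W v∈
        A , A∈L , v∈A = weight-∋ L (≤-trans (≤-reflexive (sym (𝟙-∈ v∈W))) (covers v∈V))
    in weight-∈ (List.∈-map⁺ (_∩ W) A∈L) (x∈p∩q⁺ (v∈A , v∈W))
  k′coloring = cover⇒coloring {G = G ↾ W} restricted restricted-covers
  coloring = proj₁ (proj₂ k′coloring)
  k′≡k : proj₁ k′coloring ≡ k
  k′≡k = ≤-antisym
    (≤-trans (proj₂ (proj₂ k′coloring)) (≤-trans (≤-reflexive (length-map (_∩ W) L)) len))
    (subst (_≤ proj₁ k′coloring) ∣K∩W∣≡k (clique≤coloring {G = G ↾ W} cK∩W coloring))

perfect-complement : Perfect G → Perfect (complement G)
perfect-complement {G = G} perf =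
  perfectFor⇒perfect {G = complement G} (perfectFor-complement {G = G} (perfect⇒perfectFor {G = G} perf))

-- Replicated graphs

sum-split : ∀ m {k} (f : Fin (m + k) → ℕ) → sum f ≡ sum (f ∘ (_↑ˡ k)) + sum (f ∘ (m ↑ʳ_))
sum-split zero    f = refl
sum-split (suc m) f = trans (cong (f zero +_) (sum-split m (f ∘ suc))) (sym (+-assoc (f zero) _ _))

sum-combine : ∀ n {m} (f : Fin (n * m) → ℕ) → sum f ≡ ∑[ v < n ] ∑[ j < m ] f (combine v j)
sum-combine zero        f = refl
sum-combine (suc n) {m} f =
  trans (sum-split m f) (cong (sum (f ∘ (_↑ˡ (n * m))) +_) (sum-combine n (f ∘ (m ↑ʳ_))))

∣∣≡sum : ∀ (A : Subset n) → ∣ A ∣ ≡ sum (𝟙 A)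
∣∣≡sum []            = refl
∣∣≡sum (inside  ∷ A) = cong suc (∣∣≡sum A)
∣∣≡sum (outside ∷ A) = ∣∣≡sum A

term≤sum : ∀ {n} (f : Fin n → ℕ) i → f i ≤ sum f
term≤sum f zero    = m≤m+n _ _
term≤sum f (suc i) = ≤-trans (term≤sum (f ∘ suc) i) (m≤n+m _ _)

initial-≤sum : ∀ {n k} {f : Fin n → ℕ} → k ≤ n → (∀ i → toℕ i < k → 1 ≤ f i) → k ≤ sum f
initial-≤sum z≤n       _  = z≤n
initial-≤sum (s≤s k≤n) 1≤ = +-mono-≤ (1≤ zero (s≤s z≤n)) (initial-≤sum k≤n λ i i<k → 1≤ (suc i) (s≤s i<k))

sum≤initial : ∀ {n} k {f : Fin n → ℕ} → (∀ i → f i ≤ 1) → (∀ i → 1 ≤ f i → toℕ i < k) → sum f ≤ k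
sum≤initial {zero}  k       _   _   = z≤n
sum≤initial {suc n} zero {f} ≤1 <k  =
  +-mono-≤ (≮⇒≥ λ 1≤ → n≮0 (<k zero 1≤)) (sum≤initial zero (≤1 ∘ suc) λ i 1≤ → ⊥-elim (n≮0 (<k (suc i) 1≤)))
sum≤initial {suc n} (suc k) ≤1  <k  =
  +-mono-≤ (≤1 zero) (sum≤initial k (≤1 ∘ suc) λ i 1≤ → s≤s⁻¹ (<k (suc i) 1≤))

module Replication {n} (G : Graph n) (𝒞 : List (Subset n)) where
  open Graph G using (_~_)
  private
    V = vertices G
    m = length 𝒞
    w = weight 𝒞
    R = replicated G 𝒞

  -- These coordinates unfold to the same terms as the local ones of `replicated`, which cannot be
  -- named from outside.
  original : Fin (n * m) → Fin n
  original x = proj₁ (remQuot {n} m x)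

  index : Fin (n * m) → Fin m
  index x = proj₂ (remQuot {n} m x)

  copy : Fin n → Fin m → Fin (n * m)
  copy = combine

  copy-original-index : ∀ x → copy (original x) (index x) ≡ x
  copy-original-index = combine-remQuot {n} m

  original-copy : ∀ v j → original (copy v j) ≡ v
  original-copy v j = cong proj₁ (remQuot-combine {n} v j)

  index-copy : ∀ v j → index (copy v j) ≡ j
  index-copy v j = cong proj₂ (remQuot-combine {n} v j)

  copy? : ∀ x → Dec (original x ∈ V × toℕ (index x) < w (original x))
  copy? x = (original x ∈? V) ×-dec (toℕ (index x) <? w (original x))

  copy-∈⁺ : ∀ {v j} → v ∈ V → toℕ j < w v → copy v j ∈ vertices R
  copy-∈⁺ {v} {j} v∈V j<w = ∈-comprehension⁺ copy?
    (subst₂ (λ u i → u ∈ V × toℕ i < w u) (sym (original-copy v j)) (sym (index-copy v j)) (v∈V , j<w))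

  copy-∈⁻ : ∀ {v j} → copy v j ∈ vertices R → v ∈ V × toℕ j < w v
  copy-∈⁻ {v} {j} x∈ =
    subst₂ (λ u i → u ∈ V × toℕ i < w u) (original-copy v j) (index-copy v j) (∈-comprehension⁻ copy? x∈)

  copyOf? : ∀ A x → Dec (x ∈ vertices R × original x ∈ A)
  copyOf? A x = (x ∈? vertices R) ×-dec (original x ∈? A)

  copies : Subset n → Subset (n * m)
  copies A = comprehension (copyOf? A)

  copies-stable : ∀ {A} → Stable G A → Stable R (copies A)
  copies-stable {A} sA =
    proj₁ ∘ ∈-comprehension⁻ (copyOf? A) ,
    λ x∈ y∈ x≢y → x≢y , stable⇒≁ {G = G} sA (proj₂ (∈-comprehension⁻ (copyOf? A) x∈))
                                            (proj₂ (∈-comprehension⁻ (copyOf? A) y∈))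

  weight≤∣copies∣ : ∀ {A} → A ⊆ V → 𝟙 A · w ≤ ∣ copies A ∣
  weight≤∣copies∣ {A} A⊆V = begin
    𝟙 A · w                                               ≤⟨ sum-mono pointwise ⟩
    ∑[ v < n ] ∑[ j < m ] 𝟙 (copies A) (copy v j)         ≡⟨ sum-combine n (𝟙 (copies A)) ⟨
    sum (𝟙 (copies A))                                    ≡⟨ ∣∣≡sum (copies A) ⟨
    ∣ copies A ∣                                          ∎
    where
    open ≤-Reasoning
    pointwise : ∀ v → 𝟙 A v * w v ≤ ∑[ j < m ] 𝟙 (copies A) (copy v j)
    pointwise v with v ∈? A
    ... | no  _   = z≤n
    ... | yes v∈A = ≤-trans (≤-reflexive (*-identityˡ (w v)))
      -- `w v` counts members of `𝒞`, so it is at most `m` and all copies of v fit into its row.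
      (initial-≤sum (length-filter (v ∈?_) 𝒞) λ j j<w → ≤-reflexive (sym (𝟙-∈
        (∈-comprehension⁺ (copyOf? A)
          (copy-∈⁺ (A⊆V v∈A) j<w , subst (_∈ A) (sym (original-copy v j)) v∈A)))))

  copyIn? : ∀ S′ v → Dec (v ∈ V × ∃ λ (j : Fin m) → copy v j ∈ S′)
  copyIn? S′ v = (v ∈? V) ×-dec any? λ j → copy v j ∈? S′

  -- A vertex v has only `w v` copies to offer to S′, and it has one in S′ only if it is among the
  -- originals.
  ∣∣≤weight : ∀ {S′} → S′ ⊆ vertices R → ∣ S′ ∣ ≤ 𝟙 (originals G m S′) · w
  ∣∣≤weight {S′} S′⊆ = begin
    ∣ S′ ∣                                     ≡⟨ ∣∣≡sum S′ ⟩
    sum (𝟙 S′)                                 ≡⟨ sum-combine n (𝟙 S′) ⟩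
    ∑[ v < n ] ∑[ j < m ] 𝟙 S′ (copy v j)      ≤⟨ sum-mono pointwise ⟩
    𝟙 (originals G m S′) · w                   ∎
    where
    open ≤-Reasoning
    pointwise : ∀ v → ∑[ j < m ] 𝟙 S′ (copy v j) ≤ 𝟙 (originals G m S′) v * w v
    pointwise v = sum≤initial _ (𝟙≤1 S′ ∘ copy v) λ j 1≤ →
      let x∈S′ = 𝟙-positive 1≤
          v∈V , j<w = copy-∈⁻ (S′⊆ x∈S′)
          v∈S = ∈-comprehension⁺ (copyIn? S′) (v∈V , j , x∈S′)
      in subst (toℕ j <_) (trans (sym (*-identityˡ (w v))) (cong (_* w v) (sym (𝟙-∈ v∈S)))) j<w

  originals-stable : ∀ {S′} → Stable R S′ → Stable G (originals G m S′)
  originals-stable {S′} (S′⊆ , sS′) = proj₁ ∘ ∈-comprehension⁻ (copyIn? S′) , λ {u} {v} u∈ v∈ u≢v →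
    let _ , i , x∈ = ∈-comprehension⁻ (copyIn? S′) u∈
        _ , j , y∈ = ∈-comprehension⁻ (copyIn? S′) v∈
        x≢y x≡y = u≢v (trans (sym (original-copy u i)) (trans (cong original x≡y) (original-copy v j)))
    in u≢v , λ u~v → proj₂ (sS′ x∈ y∈ x≢y)
                       (subst₂ _~_ (sym (original-copy u i)) (sym (original-copy v j)) u~v)

  -- Copies of one vertex are nonadjacent, so a clique of G lifted into W may use only one copy of
  -- each vertex; `choice` fixes that copy as a function of the vertex.
  module Representatives (W : Subset (n * m)) where
    choice? : ∀ v → Dec (∃ λ (j : Fin m) → copy v j ∈ W)
    choice? v = any? λ j → copy v j ∈? W

    choice : Fin n → Maybe (Fin m)
    choice v = first (choice? v)
      where
      first : Dec (∃ λ j → copy v j ∈ W) → Maybe (Fin m)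
      first (yes (j , _)) = just j
      first (no _)        = nothing

    choice-just : ∀ {v} → (∃ λ j → copy v j ∈ W) → ∃ λ j → choice v ≡ just j × copy v j ∈ W
    choice-just {v} some with choice? v
    ... | no none      = ⊥-elim (none some)
    ... | yes (j , x∈) = j , refl , x∈

    Representative : Subset n → Fin (n * m) → Set
    Representative K x = x ∈ W × original x ∈ K × choice (original x) ≡ just (index x)

    representative? : ∀ K x → Dec (Representative K x)
    representative? K x =
      (x ∈? W) ×-dec (original x ∈? K) ×-dec Maybe.≡-dec _≟ᶠ_ (choice (original x)) (just (index x))

    representatives : Subset n → Subset (n * m)
    representatives K = comprehension (representative? K)

    -- Representatives of the same vertex share the chosen index and so coincide; distinct ones
    -- therefore lie over distinct vertices of K.
    representatives-clique : ∀ {K} → W ⊆ vertices R → IsClique G K → IsClique R (representatives K)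
    representatives-clique {K} W⊆ cK =
      W⊆ ∘ proj₁ ∘ ∈-comprehension⁻ (representative? K) , λ {x} {y} x∈ y∈ x≢y →
        let _ , x∈K , cx = ∈-comprehension⁻ (representative? K) x∈
            _ , y∈K , cy = ∈-comprehension⁻ (representative? K) y∈
        in proj₂ cK x∈K y∈K λ x≡y → x≢y (trans (sym (copy-original-index x)) (trans
             (cong₂ copy x≡y (Maybe.just-injective (trans (sym cx) (trans (cong choice x≡y) cy))))
             (copy-original-index y)))

    ∣∩originals∣≤ : ∀ K → ∣ K ∩ originals G m W ∣ ≤ ∣ representatives K ∣
    ∣∩originals∣≤ K = begin
      ∣ K ∩ originals G m W ∣                                      ≡⟨ ∣∣≡sum (K ∩ originals G m W) ⟩
      sum (𝟙 (K ∩ originals G m W))                                ≤⟨ sum-mono pointwise ⟩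
      ∑[ v < n ] ∑[ j < m ] 𝟙 (representatives K) (copy v j)       ≡⟨ sum-combine n _ ⟨
      sum (𝟙 (representatives K))                                  ≡⟨ ∣∣≡sum (representatives K) ⟨
      ∣ representatives K ∣                                        ∎
      where
      open ≤-Reasoning
      pointwise : ∀ v → 𝟙 (K ∩ originals G m W) v ≤ ∑[ j < m ] 𝟙 (representatives K) (copy v j)
      pointwise v with v ∈? K ∩ originals G m W
      ... | no  _  = z≤n
      ... | yes v∈ =
        let v∈K , v∈O = x∈p∩q⁻ K _ v∈
            j , cv , x∈W = choice-just (proj₂ (∈-comprehension⁻ (copyIn? W) v∈O))
            x∈ = ∈-comprehension⁺ (representative? K) (x∈W ,
                   subst₂ (λ u i → u ∈ K × choice u ≡ just i)
                     (sym (original-copy v j)) (sym (index-copy v j)) (v∈K , cv))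
        in ≤-trans (≤-reflexive (sym (𝟙-∈ x∈))) (term≤sum (𝟙 (representatives K) ∘ copy v) j)

  -- Colour the vertices with a copy in `vertices R ∩ W` and let each class take all copies of its
  -- members. The clique bound transfers because cliques of G lift to representatives.
  replicated-perfectFor : (∀ W → PerfectFor G (𝟙 W)) → ∀ W → PerfectFor R (𝟙 W)
  replicated-perfectFor perf W k bound =
    let L , stable , len , cover = perf (originals G m (vertices R ∩ W)) k bound′ in
    map copies L , All.map⁺ (All.map copies-stable stable) ,
    ≤-trans (≤-reflexive (length-map copies L)) len , λ {x} x∈R → case x ∈? W of λ where
      (no x∉W)  → ≤-trans (≤-reflexive (𝟙-∉ x∉W)) z≤n
      (yes x∈W) →
        let v∈V = proj₁ (∈-comprehension⁻ copy? x∈R)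
            x∈ = subst (_∈ vertices R ∩ W) (sym (copy-original-index x)) (x∈p∩q⁺ (x∈R , x∈W))
            v∈O = ∈-comprehension⁺ (copyIn? (vertices R ∩ W)) (v∈V , index x , x∈)
            A , A∈L , v∈A = weight-∋ L (≤-trans (≤-reflexive (sym (𝟙-∈ v∈O))) (cover v∈V))
        in ≤-trans (𝟙≤1 W x) (weight-∈ (List.∈-map⁺ copies A∈L) (∈-comprehension⁺ (copyOf? A) (x∈R , v∈A)))
    where
    open ≤-Reasoning
    open Representatives (vertices R ∩ W)
    bound′ : Bounded G (𝟙 (originals G m (vertices R ∩ W))) k
    bound′ {K} cK = begin
      𝟙 K · 𝟙 (originals G m (vertices R ∩ W))    ≡⟨ 𝟙·𝟙 K _ ⟩
      ∣ K ∩ originals G m (vertices R ∩ W) ∣      ≤⟨ ∣∩originals∣≤ K ⟩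
      ∣ representatives K ∣                       ≤⟨ p⊆q⇒∣p∣≤∣q∣ (λ x∈ → x∈p∩q⁺ (x∈ ,
          p∩q⊆q _ W (proj₁ (∈-comprehension⁻ (representative? K) x∈)))) ⟩
      ∣ representatives K ∩ W ∣                   ≡⟨ 𝟙·𝟙 (representatives K) W ⟨
      𝟙 (representatives K) · 𝟙 W                 ≤⟨ bound (representatives-clique (p∩q⊆p _ W) cK) ⟩
      k                                           ∎

  replicated-perfect : Perfect G → Perfect R
  replicated-perfect perf = perfectFor⇒perfect {G = R} (replicated-perfectFor (perfect⇒perfectFor {G = G} perf))

  -- Some colour class of an optimal colouring of G weighs at least m, hence so does
  -- S; as S meets each of the m cliques at most once, it meets all of them.
  originals-hit : ∀ {ω S′} → Perfect G → (∀ {K} → IsClique G K → ∣ K ∣ ≤ ω) → 1 ≤ ω →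
    All (λ C → IsClique G C × ω ≤ ∣ C ∣) 𝒞 →
    Stable R S′ → (∀ {A} → Stable R A → ∣ A ∣ ≤ ∣ S′ ∣) →
    All (λ C → 1 ≤ ∣ C ∩ originals G m S′ ∣) 𝒞
  originals-hit {ω} {S′} perf clique≤ω 1≤ω cliques sS′ maximum
    with L , stable , len , cover ← perfect⇒perfectFor {G = G} perf V ω (λ {K} cK →
           ≤-trans (≤-reflexive (𝟙·𝟙 K V)) (≤-trans (p⊆q⇒∣p∣≤∣q∣ (p∩q⊆p K V)) (clique≤ω cK)))
    = All.tabulate λ {C} C∈𝒞 → ≮⇒≥ λ missed → <-irrefl refl (begin-strict
      m                       ≤⟨ m≤∣S′∣ stable len cover ⟩
      ∣ S′ ∣                  ≤⟨ ∣∣≤weight (proj₁ sS′) ⟩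
      𝟙 S · w                 ≡⟨ ·-comm (𝟙 S) w ⟩
      w · 𝟙 S                 <⟨ weight-·-< {f = 𝟙 S}
          (All.map (λ {C} (cC , _) → ≤-trans (≤-reflexive (trans (𝟙·𝟙 C S) (cong ∣_∣ (∩-comm C S))))
             (stable-clique {G = G} (originals-stable sS′) cC)) cliques)
          (List.lose C∈𝒞 (≤-trans (≤-reflexive (𝟙·𝟙 C S)) (s≤s⁻¹ missed))) ⟩
      m                       ∎)
    where
    open ≤-Reasoning
    S = originals G m S′
    m≤∣S′∣ : ∀ {L} → All (Stable G) L → length L ≤ ω →
      (∀ {v} → v ∈ V → 𝟙 V v ≤ weight L v) → m ≤ ∣ S′ ∣
    -- Counted by cliques, the total weight of V is at least m ω; counted by the at most ω colour
    -- classes, it is at most ω `∣ S′ ∣`.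
    m≤∣S′∣ {L} stable len cover = *-cancelʳ-≤ m ∣ S′ ∣ ω {{>-nonZero 1≤ω}} (begin
      m * ω                   ≤⟨ weight-·-≥ {f = 𝟙 V} (All.map (λ {C} (cC , ω≤) → ≤-trans ω≤ (≤-trans
                                   (p⊆q⇒∣p∣≤∣q∣ λ v∈C → x∈p∩q⁺ (v∈C , proj₁ cC v∈C))
                                   (≤-reflexive (sym (𝟙·𝟙 C V))))) cliques) ⟩
      w · 𝟙 V                 ≡⟨ ·-comm w (𝟙 V) ⟩
      𝟙 V · w                 ≤⟨ sum-mono (λ v → *-monoˡ-≤ (w v) (cover′ v)) ⟩
      weight L · w            ≤⟨ weight-·-≤ {f = w} (All.map (λ {A} (sA : Stable G A) →
                                   ≤-trans (weight≤∣copies∣ {A} (proj₁ sA)) (maximum (copies-stable sA))) stable) ⟩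
      length L * ∣ S′ ∣       ≤⟨ *-monoˡ-≤ ∣ S′ ∣ len ⟩
      ω * ∣ S′ ∣              ≡⟨ *-comm ω ∣ S′ ∣ ⟩
      ∣ S′ ∣ * ω              ∎)
      where
      cover′ : ∀ v → 𝟙 V v ≤ weight L v
      cover′ v with v ∈? V
      ... | no  _   = z≤n
      ... | yes v∈V = ≤-trans (≤-reflexive (sym (𝟙-∈ v∈V))) (cover v∈V)

-- Linear independence of the collected cliques

sumᶻ-zero : ∀ {n} {f : Fin n → ℤ} → (∀ i → f i ≡ 0ℤ) → sumᶻ f ≡ 0ℤ
sumᶻ-zero {n} f≡0 = trans (sumᶻ-cong f≡0) (ℤΣ.sum-replicate-zero n)

-- Gaussian elimination without division: given a vector x p with nonzero first coordinate d,
-- each other vector x j is replaced by d (x j) − (x j 0) (x p), whose first coordinate vanishes.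
linearly-dependent : ∀ {n m} (V : Subset n) (x : Fin m → Fin n → ℤ) →
  (∀ j {v} → v ∉ V → x j v ≡ 0ℤ) → ∣ V ∣ < m →
  Σ[ a ∈ (Fin m → ℤ) ] (∃[ j ] a j ≢ 0ℤ) × (∀ v → sumᶻ (λ j → a j *ᶻ x j v) ≡ 0ℤ)
linearly-dependent {m = suc m} [] x supported _ = (λ _ → 1ℤ) , (zero , λ ()) , λ ()
linearly-dependent (outside ∷ V) x supported small =
  let a , nonzero , relation = linearly-dependent V (λ j v → x j (suc v))
        (λ j v∉V → supported j λ where (there v∈V) → v∉V v∈V) small
  in a , nonzero , λ where
    zero    → sumᶻ-zero λ j → trans (cong (a j *ᶻ_) (supported j λ ())) (ℤ.*-zeroʳ (a j))
    (suc v) → relation v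
linearly-dependent {m = m} (inside ∷ V) x supported small with any? (λ j → ¬? (x j zero ≟ᶻ 0ℤ))
... | no none =
  let a , nonzero , relation = linearly-dependent V (λ j v → x j (suc v))
        (λ j v∉V → supported j λ where (there v∈V) → v∉V v∈V) (<-trans (n<1+n _) small)
  in a , nonzero , λ where
    zero    → sumᶻ-zero λ j → trans
      (cong (a j *ᶻ_) (decidable-stable (x j zero ≟ᶻ 0ℤ) λ ≢0 → none (j , ≢0))) (ℤ.*-zeroʳ (a j))
    (suc v) → relation v
linearly-dependent {m = suc m} (inside ∷ V) x supported small | yes (p , d≢0) =
  let b , (j , bj≢0) , relation = linearly-dependent V (λ j v → y j (suc v)) y-supported (s≤s⁻¹ small)
  in a b , (punchIn p j , a≢0 b j bj≢0) , λ where
    zero    → trans (reduce b zero) (sumᶻ-zero λ j → cancel (b j) d (x (punchIn p j) zero))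
    (suc v) → trans (reduce b (suc v)) (relation v)
  where
  d = x p zero
  y : Fin m → Fin _ → ℤ
  y j v = d *ᶻ x (punchIn p j) v -ᶻ x (punchIn p j) zero *ᶻ x p v
  y-supported : ∀ j {v} → v ∉ V → y j (suc v) ≡ 0ℤ
  y-supported j v∉V
    rewrite supported (punchIn p j) {suc _} (λ where (there v∈V) → v∉V v∈V)
          | supported p {suc _} (λ where (there v∈V) → v∉V v∈V)
          | ℤ.*-zeroʳ d | ℤ.*-zeroʳ (x (punchIn p j) zero) = refl
  cancel : ∀ b d c → b *ᶻ (d *ᶻ c -ᶻ c *ᶻ d) ≡ 0ℤ
  cancel = solve-∀
  -- Expanding `y` in a relation with coefficients b leaves `d *ᶻ b j` at the other vectors and
  -- collects this sum at `p`.
  aₚ : (Fin m → ℤ) → ℤ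
  aₚ b = sumᶻ (λ j → b j *ᶻ - x (punchIn p j) zero)
  a : (Fin m → ℤ) → Fin (suc m) → ℤ
  a b = insertAt (λ j → d *ᶻ b j) p (aₚ b)
  a≢0 : ∀ b j → b j ≢ 0ℤ → a b (punchIn p j) ≢ 0ℤ
  a≢0 b j bj≢0 eq with ℤ.i*j≡0⇒i≡0∨j≡0 d (trans (sym (insertAt-punchIn (λ j → d *ᶻ b j) p (aₚ b) j)) eq)
  ... | inj₁ d≡0  = d≢0 d≡0
  ... | inj₂ bj≡0 = bj≢0 bj≡0
  rearrange : ∀ b d c xj xp → b *ᶻ - c *ᶻ xp +ᶻ d *ᶻ b *ᶻ xj ≡ b *ᶻ (d *ᶻ xj -ᶻ c *ᶻ xp)
  rearrange = solve-∀
  reduce : ∀ b v → sumᶻ (λ i → a b i *ᶻ x i v) ≡ sumᶻ (λ j → b j *ᶻ y j v)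
  reduce b v = begin
    sumᶻ (λ i → a b i *ᶻ x i v)
      ≡⟨ ℤΣ.sum-remove {i = p} (λ i → a b i *ᶻ x i v) ⟩
    a b p *ᶻ x p v +ᶻ sumᶻ (λ j → a b (punchIn p j) *ᶻ x (punchIn p j) v)
      ≡⟨ cong₂ _+ᶻ_ (cong (_*ᶻ x p v) (insertAt-lookup _ p (aₚ b)))
           (sumᶻ-cong λ j → cong (_*ᶻ x (punchIn p j) v) (insertAt-punchIn (λ j → d *ᶻ b j) p (aₚ b) j)) ⟩
    aₚ b *ᶻ x p v +ᶻ sumᶻ (λ j → d *ᶻ b j *ᶻ x (punchIn p j) v)
      ≡⟨ cong (_+ᶻ sumᶻ (λ j → d *ᶻ b j *ᶻ x (punchIn p j) v))
           (ℤΣ.*-distribʳ-sum (x p v) (λ j → b j *ᶻ - x (punchIn p j) zero)) ⟩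
    sumᶻ (λ j → b j *ᶻ - x (punchIn p j) zero *ᶻ x p v) +ᶻ sumᶻ (λ j → d *ᶻ b j *ᶻ x (punchIn p j) v)
      ≡⟨ ℤΣ.∑-distrib-+ (λ j → b j *ᶻ - x (punchIn p j) zero *ᶻ x p v) _ ⟨
    sumᶻ (λ j → b j *ᶻ - x (punchIn p j) zero *ᶻ x p v +ᶻ d *ᶻ b j *ᶻ x (punchIn p j) v)
      ≡⟨ sumᶻ-cong (λ j → rearrange (b j) d (x (punchIn p j) zero) (x (punchIn p j) v) (x p v)) ⟩
    sumᶻ (λ j → b j *ᶻ y j v) ∎
    where open ≡-Reasoning

χ : Subset n → Fin n → ℤ
χ A v = pos (𝟙 A v)

χ-product : ∀ (A B : Subset n) → sumᶻ (λ v → χ A v *ᶻ χ B v) ≡ pos ∣ A ∩ B ∣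
χ-product []            []            = refl
χ-product (inside  ∷ A) (inside  ∷ B) = cong (1ℤ +ᶻ_) (χ-product A B)
χ-product (inside  ∷ A) (outside ∷ B) = trans (ℤ.+-identityˡ _) (χ-product A B)
χ-product (outside ∷ A) (_       ∷ B) = trans (ℤ.+-identityˡ _) (χ-product A B)

-- The scalar product of the relation with `χ T`, with the two sums exchanged.
pair-with : ∀ {m n} (C : Fin m → Subset n) (a : Fin m → ℤ) → (∀ v → sumᶻ (λ j → a j *ᶻ χ (C j) v) ≡ 0ℤ) →
  ∀ T → sumᶻ (λ j → a j *ᶻ pos ∣ C j ∩ T ∣) ≡ 0ℤ
pair-with C a relation T = begin
  sumᶻ (λ j → a j *ᶻ pos ∣ C j ∩ T ∣)
    ≡⟨ sumᶻ-cong (λ j → cong (a j *ᶻ_) (χ-product (C j) T)) ⟨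
  sumᶻ (λ j → a j *ᶻ sumᶻ (λ v → χ (C j) v *ᶻ χ T v))
    ≡⟨ sumᶻ-cong (λ j → ℤΣ.*-distribˡ-sum (a j) (λ v → χ (C j) v *ᶻ χ T v)) ⟩
  sumᶻ (λ j → sumᶻ (λ v → a j *ᶻ (χ (C j) v *ᶻ χ T v)))
    ≡⟨ ℤΣ.∑-comm (λ j v → a j *ᶻ (χ (C j) v *ᶻ χ T v)) ⟩
  sumᶻ (λ v → sumᶻ (λ j → a j *ᶻ (χ (C j) v *ᶻ χ T v)))
    ≡⟨ sumᶻ-zero (λ v → begin
         sumᶻ (λ j → a j *ᶻ (χ (C j) v *ᶻ χ T v))  ≡⟨ sumᶻ-cong (λ j → ℤ.*-assoc (a j) (χ (C j) v) (χ T v)) ⟨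
         sumᶻ (λ j → a j *ᶻ χ (C j) v *ᶻ χ T v)    ≡⟨ ℤΣ.*-distribʳ-sum (χ T v) (λ j → a j *ᶻ χ (C j) v) ⟨
         sumᶻ (λ j → a j *ᶻ χ (C j) v) *ᶻ χ T v    ≡⟨ cong (_*ᶻ χ T v) (relation v) ⟩
         0ℤ *ᶻ χ T v                               ≡⟨ ℤ.*-zeroˡ (χ T v) ⟩
         0ℤ                                        ∎) ⟩
  0ℤ ∎
  where open ≡-Reasoning

-- The newest clique comes first, and S is the set output in the iteration that found it. The
-- intersection sizes form a triangular pattern that certifies independence.
data Chain {n} : List (Subset n) → Set where
  []   : Chain []
  extend : ∀ {C 𝒞} (S : Subset n) → All (λ B → ∣ B ∩ S ∣ ≡ 1) 𝒞 → ∣ C ∩ S ∣ ≡ 0 →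
    Chain 𝒞 → Chain (C ∷ 𝒞)

sumᶻ-constant : ∀ {𝒞 : List (Subset n)} {T k} → All (λ C → ∣ C ∩ T ∣ ≡ k) 𝒞 → (a : Fin (length 𝒞) → ℤ) →
  sumᶻ (λ j → a j *ᶻ pos ∣ lookup 𝒞 j ∩ T ∣) ≡ sumᶻ a *ᶻ pos k
sumᶻ-constant {𝒞 = 𝒞} {T} {k} const a =
  trans (sumᶻ-cong λ j → cong (λ l → a j *ᶻ pos l) (All.lookup const (List.∈-lookup j)))
        (sym (ℤΣ.*-distribʳ-sum (pos k) a))

-- Pairing with S shows that the coefficients of the earlier cliques sum to 0; pairing with `⊤` then
-- gives `a zero` times ω equal to 0. The head drops out and induction applies.
chain-independent : ∀ {ω} {𝒞 : List (Subset n)} → 1 ≤ ω → All (λ C → ∣ C ∣ ≡ ω) 𝒞 → Chain 𝒞 →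
  (a : Fin (length 𝒞) → ℤ) → (∀ v → sumᶻ (λ j → a j *ᶻ χ (lookup 𝒞 j) v) ≡ 0ℤ) → ∀ j → a j ≡ 0ℤ
chain-independent {ω = suc ω} {C ∷ 𝒞} 1≤ω (∣C∣≡ω ∷ sizes) (extend S hit missed chain) a relation =
  λ where zero → a₀≡0
          (suc j) → chain-independent 1≤ω sizes chain (a ∘ suc) relation′ j
  where
  open ≡-Reasoning
  rest = sumᶻ (a ∘ suc)
  rest≡0 : rest ≡ 0ℤ
  rest≡0 = begin
    rest
      ≡⟨ ℤ.*-identityʳ rest ⟨
    rest *ᶻ 1ℤ
      ≡⟨ sumᶻ-constant hit (a ∘ suc) ⟨
    sumᶻ (λ j → a (suc j) *ᶻ pos ∣ lookup 𝒞 j ∩ S ∣)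
      ≡⟨ ℤ.+-identityˡ _ ⟨
    0ℤ +ᶻ sumᶻ (λ j → a (suc j) *ᶻ pos ∣ lookup 𝒞 j ∩ S ∣)
      ≡⟨ cong (_+ᶻ sumᶻ (λ j → a (suc j) *ᶻ pos ∣ lookup 𝒞 j ∩ S ∣))
           (trans (cong (λ k → a zero *ᶻ pos k) missed) (ℤ.*-zeroʳ (a zero))) ⟨
    sumᶻ (λ j → a j *ᶻ pos ∣ lookup (C ∷ 𝒞) j ∩ S ∣)
      ≡⟨ pair-with (lookup (C ∷ 𝒞)) a relation S ⟩
    0ℤ ∎
  sizes∩⊤ : All (λ A → ∣ A ∩ ⊤ ∣ ≡ suc ω) (C ∷ 𝒞)
  sizes∩⊤ = All.map (λ {A} → trans (cong ∣_∣ (∩-identityʳ A))) (∣C∣≡ω ∷ sizes)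
  a₀ω≡0 : a zero *ᶻ pos (suc ω) ≡ 0ℤ
  a₀ω≡0 = begin
    a zero *ᶻ pos (suc ω)
      ≡⟨ ℤ.+-identityʳ _ ⟨
    a zero *ᶻ pos (suc ω) +ᶻ 0ℤ *ᶻ pos (suc ω)
      ≡⟨ cong (λ i → a zero *ᶻ pos (suc ω) +ᶻ i *ᶻ pos (suc ω)) rest≡0 ⟨
    a zero *ᶻ pos (suc ω) +ᶻ rest *ᶻ pos (suc ω)
      ≡⟨ ℤ.*-distribʳ-+ (pos (suc ω)) (a zero) rest ⟨
    sumᶻ a *ᶻ pos (suc ω)
      ≡⟨ sumᶻ-constant sizes∩⊤ a ⟨
    sumᶻ (λ j → a j *ᶻ pos ∣ lookup (C ∷ 𝒞) j ∩ ⊤ ∣)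
      ≡⟨ pair-with (lookup (C ∷ 𝒞)) a relation ⊤ ⟩
    0ℤ ∎
  a₀≡0 : a zero ≡ 0ℤ
  a₀≡0 with ℤ.i*j≡0⇒i≡0∨j≡0 (a zero) a₀ω≡0
  ... | inj₁ eq = eq
  relation′ : ∀ v → sumᶻ (λ j → a (suc j) *ᶻ χ (lookup 𝒞 j) v) ≡ 0ℤ
  relation′ v = begin
    sumᶻ (λ j → a (suc j) *ᶻ χ (lookup 𝒞 j) v)
      ≡⟨ ℤ.+-identityˡ _ ⟨
    0ℤ *ᶻ χ C v +ᶻ sumᶻ (λ j → a (suc j) *ᶻ χ (lookup 𝒞 j) v)
      ≡⟨ cong (λ i → i *ᶻ χ C v +ᶻ sumᶻ (λ j → a (suc j) *ᶻ χ (lookup 𝒞 j) v)) a₀≡0 ⟨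
    sumᶻ (λ j → a j *ᶻ χ (lookup (C ∷ 𝒞) j) v)
      ≡⟨ relation v ⟩
    0ℤ ∎

-- More than `∣ V ∣` vectors supported on V would be linearly dependent.
chain-length : ∀ {V : Subset n} {ω 𝒞} → 1 ≤ ω → All (λ C → C ⊆ V × ∣ C ∣ ≡ ω) 𝒞 → Chain 𝒞 → length 𝒞 ≤ ∣ V ∣
chain-length {V = V} {𝒞 = 𝒞} 1≤ω cliques chain = ≮⇒≥ λ small →
  let a , (j , aj≢0) , relation = linearly-dependent V (χ ∘ lookup 𝒞) supported small
  in aj≢0 (chain-independent 1≤ω (All.map proj₂ cliques) chain a relation j)
  where
  supported : ∀ j {v} → v ∉ V → χ (lookup 𝒞 j) v ≡ 0ℤ
  supported j v∉V = cong pos (𝟙-∉ λ v∈C → v∉V (proj₁ (All.lookup cliques (List.∈-lookup j)) v∈C))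

-- Correctness of the procedures and of the algorithm

perfect-on : ∀ {Y} → Perfect G → Y ⊆ vertices G → Perfect (G on Y)
perfect-on {G = G} {Y} perf Y⊆V W =
  subst (λ X → ∃[ k ] IsChromaticNumber (G on X) k × IsCliqueNumber (G on X) k)
    (⊆-antisym (p∩q⊆q _ (Y ∩ W)) λ v∈ → x∈p∩q⁺ (Y⊆V (p∩q⊆p Y W v∈) , v∈))
    (perf (Y ∩ W))

subset-of-size : ∀ (K : Subset n) {k} → k ≤ ∣ K ∣ → ∃[ J ] J ⊆ K × ∣ J ∣ ≡ k
subset-of-size {n} K {zero} _ = ⊥ , ⊥⊆ , ∣⊥∣≡0 n
subset-of-size (outside ∷ K) {suc k} k≤ =
  let J , J⊆K , eq = subset-of-size K k≤ in outside ∷ J , s⊆s J⊆K , eq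
subset-of-size (inside ∷ K) {suc k} k≤ =
  let J , J⊆K , eq = subset-of-size K (s≤s⁻¹ k≤) in inside ∷ J , s⊆s J⊆K , cong suc eq

-- Dropping vertices leaves a clique. This downward closure turns the point found by binary search
-- into the clique number.
hasClique-≤ : ∀ {k l} → k ≤ l → HasClique G l → HasClique G k
hasClique-≤ {G = G} k≤l (K , cK , refl) =
  let J , J⊆K , eq = subset-of-size K k≤l in J , clique-mono {G = G} J⊆K cK , eq

hasClique-⊆ : ∀ {X Y k} → X ⊆ Y → HasClique (G on X) k → HasClique (G on Y) k
hasClique-⊆ X⊆Y (K , (K⊆X , cK) , eq) = K , (X⊆Y ∘ K⊆X , cK) , eq

1≤∣∣⇒nonempty : ∀ {n} {K : Subset n} → 1 ≤ ∣ K ∣ → Nonempty K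
1≤∣∣⇒nonempty {n} {K} 1≤ with nonempty? K
... | yes some  = some
... | no  empty = ⊥-elim (<⇒≢ 1≤ (sym (trans (cong ∣_∣ (Empty-unique empty)) (∣⊥∣≡0 n))))

cliqueNumber-unique : ∀ {k l} → IsCliqueNumber G k → IsCliqueNumber G l → k ≡ l
cliqueNumber-unique (hasK , maxK) (hasL , maxL) = ≤-antisym (maxL _ hasK) (maxK _ hasL)

midpoint-between : ∀ {lo hi} → suc lo < hi → lo < ⌊ lo + hi /2⌋ × ⌊ lo + hi /2⌋ < hi
midpoint-between {lo} {hi} gap =
  (begin
    suc lo                      ≡⟨ cong suc (n≡⌊n+n/2⌋ lo) ⟩
    ⌊ 2 + (lo + lo) /2⌋         ≡⟨ cong ⌊_/2⌋ (trans (cong suc (sym (+-suc lo lo))) (sym (+-suc lo (suc lo)))) ⟩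
    ⌊ lo + suc (suc lo) /2⌋     ≤⟨ ⌊n/2⌋-mono (+-monoʳ-≤ lo gap) ⟩
    ⌊ lo + hi /2⌋               ∎) ,
  (begin
    ⌊ suc (suc lo) + hi /2⌋     ≤⟨ ⌊n/2⌋-mono (+-monoˡ-≤ hi gap) ⟩
    ⌊ hi + hi /2⌋               ≡⟨ n≡⌊n+n/2⌋ hi ⟨
    hi                          ∎)
  where open ≤-Reasoning

-- The values true at lo and false at hi are kept, so an interval of length 1 exhibits the change.
-- The fuel bounds `hi ∸ lo`, which shrinks at every halving.
binarySearch-correct : ∀ (p : ℕ → Bool) fuel {lo hi} →
  p lo ≡ true → p hi ≡ false → lo < hi → hi ≤ fuel + lo →
  let r = binarySearch p fuel lo hi in p r ≡ true × p (suc r) ≡ false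
binarySearch-correct p zero _ _ lo<hi hi≤lo = ⊥-elim (<⇒≱ lo<hi hi≤lo)
binarySearch-correct p (suc fuel) {lo} {hi} p-lo p-hi lo<hi hi≤ with hi ≤ᵇ suc lo in eq
... | true  = p-lo , subst (λ k → p k ≡ false)
    (≤-antisym (≤ᵇ⇒≤ hi (suc lo) (subst T (sym eq) _)) lo<hi) p-hi
... | false
    with lo<mid , mid<hi ← midpoint-between {lo} {hi}
           (≰⇒> λ hi≤1+lo → case trans (sym eq) (to Bool.T-≡ (≤⇒≤ᵇ hi≤1+lo)) of λ ())
    with p ⌊ lo + hi /2⌋ in p-mid
...   | true  = binarySearch-correct p fuel p-mid p-hi mid<hi
                  (≤-trans hi≤ (≤-trans (≤-reflexive (sym (+-suc fuel lo))) (+-monoʳ-≤ fuel lo<mid)))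
...   | false = binarySearch-correct p fuel p-lo p-mid lo<mid (s≤s⁻¹ (≤-trans mid<hi hi≤))

insert-∉ : ∀ {C : Subset n} {𝒞} → C List.∉ 𝒞 → insert C 𝒞 ≡ C ∷ 𝒞
insert-∉ {C = C} {𝒞} C∉𝒞 rewrite dec-false (DecMembership._∈?_ (≡-dec Bool._≟_) C 𝒞) C∉𝒞 = refl

fresh-colour : ∀ (c : Coloring n) → ∃[ a ] ∀ v → c v ≢ just a
-- One more than the sum of all colours in use, with uncoloured vertices counted as 0, exceeds each
-- of them.
fresh-colour c = suc (sum (maybe id 0 ∘ c)) , λ v cv≡ →
  <-irrefl refl (≤-trans (≤-reflexive (sym (cong (maybe id 0) cv≡))) (term≤sum (maybe id 0 ∘ c) v))

module Correctness (O : CliqueOracle) where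
  open CliqueOracle O
  open Algorithm O

  hasClique?-correct : ∀ k → Perfect G → hasClique? G k ≡ true ⇔ HasClique G k
  hasClique?-correct {n} {G} 0 _ = mk⇔ (λ _ → ⊥ , ⊥-clique G , ∣⊥∣≡0 n) (λ _ → refl)
  hasClique?-correct {G = G} 1 _ = mk⇔
    (λ eq → let v , v∈V = 1≤∣∣⇒nonempty (≤ᵇ⇒≤ 1 _ (subst T (sym eq) _)) in
            ⁅ v ⁆ , ⁅⁆-clique G v∈V , ∣⁅x⁆∣≡1 v)
    λ (K , (K⊆V , _) , ∣K∣≡1) → to Bool.T-≡ (≤⇒≤ᵇ (subst (_≤ _) ∣K∣≡1 (p⊆q⇒∣p∣≤∣q∣ K⊆V)))
  hasClique?-correct {G = G} (suc (suc k)) perf = correct G (suc (suc k)) perf (s≤s (s≤s z≤n))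

  computeω-correct : Perfect G → IsCliqueNumber G (computeω G)
  computeω-correct {G = G} perf =
    to (hasClique?-correct _ perf) (proj₁ found) ,
    λ l hasL → ≮⇒≥ λ ω<l → case trans (sym (proj₂ found))
      (from (hasClique?-correct _ perf) (hasClique-≤ {G = G} ω<l hasL)) of λ ()
    where
    hi = suc ∣ vertices G ∣
    found = binarySearch-correct (hasClique? G) hi {0} {hi} refl
      (Bool.¬-not λ eq → let K , (K⊆V , _) , ∣K∣≡hi = to (hasClique?-correct hi perf) eq in
        <-irrefl refl (subst (_≤ ∣ vertices G ∣) ∣K∣≡hi (p⊆q⇒∣p∣≤∣q∣ K⊆V)))
      (s≤s z≤n) (≤-reflexive (sym (+-identityʳ hi)))

  deleteUnlessNeeded : ℕ → Graph n → Fin n → Graph n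
  deleteUnlessNeeded k H v = if hasClique? (H ∖ ⁅ v ⁆) k then H ∖ ⁅ v ⁆ else H

  -- A vertex that could not be deleted at its turn cannot be deleted later, since the graph only
  -- shrinks; hence no processed vertex that survives is dispensable.
  deletion-minimal : ∀ k vs {X} → Perfect G → X ⊆ vertices G → HasClique (G on X) k →
    ∃[ Y ] foldl (deleteUnlessNeeded k) (G on X) vs ≡ (G on Y) × Y ⊆ X × HasClique (G on Y) k ×
      (∀ {v} → v List.∈ vs → v ∈ Y → ¬ HasClique (G on (Y ∩ ∁ ⁅ v ⁆)) k)
  deletion-minimal k [] {X} _ X⊆V has = X , refl , id , has , λ ()
  deletion-minimal {n} {G} k (v ∷ vs) {X} perf X⊆V has = decide (hasClique? (G on X∖v) k) refl
    where
    X∖v = X ∩ ∁ ⁅ v ⁆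
    X∖v⊆V : X∖v ⊆ vertices G
    X∖v⊆V = X⊆V ∘ p∩q⊆p X _
    query-correct = hasClique?-correct k (perfect-on {G = G} perf X∖v⊆V)
    after-step : ∀ b → hasClique? (G on X∖v) k ≡ b →
      foldl (deleteUnlessNeeded k) (G on X) (v ∷ vs) ≡
      foldl (deleteUnlessNeeded k) (if b then G on X∖v else (G on X)) vs
    after-step _ = cong λ b → foldl (deleteUnlessNeeded k) (if b then G on X∖v else (G on X)) vs
    decide : ∀ b → hasClique? (G on X∖v) k ≡ b →
      ∃[ Y ] foldl (deleteUnlessNeeded k) (G on X) (v ∷ vs) ≡ (G on Y) × Y ⊆ X × HasClique (G on Y) k ×
        (∀ {u} → u List.∈ v ∷ vs → u ∈ Y → ¬ HasClique (G on (Y ∩ ∁ ⁅ u ⁆)) k)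
    decide true eq =
      let Y , fold≡ , Y⊆ , hasY , minimal = deletion-minimal {G = G} k vs perf X∖v⊆V (to query-correct eq)
      in Y , trans (after-step true eq) fold≡ , p∩q⊆p X _ ∘ Y⊆ , hasY , λ where
           (here refl) v∈Y → ⊥-elim (x∈∁p⇒x∉p (p∩q⊆q X _ (Y⊆ v∈Y)) (x∈⁅x⁆ v))
           (there v∈vs)    → minimal v∈vs
    decide false eq =
      let Y , fold≡ , Y⊆ , hasY , minimal = deletion-minimal {G = G} k vs perf X⊆V has
          Y∖v⊆X∖v = λ {u} u∈ → let u∈Y , u∉v = x∈p∩q⁻ Y _ u∈ in x∈p∩q⁺ {x = u} (Y⊆ u∈Y , u∉v)
      in Y , trans (after-step false eq) fold≡ , Y⊆ , hasY , λ where
           (here refl) _ hasY∖v → case trans (sym eq)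
             (from query-correct (hasClique-⊆ {G = G} Y∖v⊆X∖v hasY∖v)) of λ ()
           (there v∈vs)    → minimal v∈vs

  -- The surviving set Y contains a clique K of size ω. A vertex of Y outside K could be deleted
  -- without harming K, against minimality, so Y is K.
  maxClique-correct : ∀ {C} → Perfect G → MaxClique G C → IsClique G C × ∣ C ∣ ≡ computeω G
  maxClique-correct {n} {G} perf (vs , (_ , ordering) , refl)
    with Y , fold≡ , Y⊆V , (K , (K⊆Y , cK) , ∣K∣≡ω) , minimal ←
           deletion-minimal {G = G} (computeω G) vs perf id (proj₁ (computeω-correct perf)) =
    subst (λ C → IsClique G C × ∣ C ∣ ≡ computeω G) (trans K≡Y (sym (cong vertices fold≡)))
      ((Y⊆V ∘ K⊆Y , cK) , ∣K∣≡ω)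
    where
    K≡Y : K ≡ Y
    K≡Y = ⊆-antisym K⊆Y λ {v} v∈Y → case v ∈? K of λ where
      (yes v∈K) → v∈K
      (no v∉K)  → ⊥-elim (minimal (from (ordering v) (Y⊆V v∈Y)) v∈Y
        (K , ((λ {u} u∈K → x∈p∩q⁺ (K⊆Y u∈K , x∉p⇒x∈∁p λ u∈v →
                v∉K (subst (_∈ K) (x∈⁅y⁆⇒x≡y v u∈v) u∈K))) , cK) , ∣K∣≡ω))

  maxClique-exists : (G : Graph n) → ∃[ C ] MaxClique G C
  maxClique-exists {n} G = _ , vs ,
    (Unique.filter⁺ (_∈? vertices G) (Unique.allFin⁺ n) ,
     λ v → mk⇔ (proj₂ ∘ List.∈-filter⁻ (_∈? vertices G) {xs = allFin n})
               (List.∈-filter⁺ (_∈? vertices G) (List.∈-allFin v))) , refl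
    where vs = filter (_∈? vertices G) (allFin n)

  hittingStableSet-exists : (G : Graph n) (𝒞 : List (Subset n)) → ∃[ S ] HittingStableSet G 𝒞 S
  hittingStableSet-exists G 𝒞 =
    let S′ , max = maxClique-exists (complement (replicated G 𝒞)) in
    originals G (length 𝒞) S′ , S′ , max , refl

  -- The graph queried is perfect, by replication and complementation, so S′ is a maximum stable set
  -- of `R`. Then `originals-hit` gives at least one common vertex with each clique, and stability
  -- at most one.
  hitting-correct : ∀ {𝒞 S} → Perfect G → 1 ≤ computeω G →
    All (λ C → IsClique G C × ∣ C ∣ ≡ computeω G) 𝒞 → HittingStableSet G 𝒞 S →
    Stable G S × All (λ C → ∣ C ∩ S ∣ ≡ 1) 𝒞
  hitting-correct {G = G} {𝒞} {S} perf 1≤ω cliques (S′ , max , refl) =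
    stable , All.map (λ (1≤ , cC) → ≤-antisym
        (subst (_≤ 1) (cong ∣_∣ (∩-comm S _)) (stable-clique {G = G} stable cC)) 1≤)
      (All.zip (hit , All.map proj₁ cliques))
    where
    open Replication G 𝒞
    R = replicated G 𝒞
    perf′ : Perfect (complement R)
    perf′ = perfect-complement {G = R} (replicated-perfect perf)
    S′-correct = maxClique-correct {G = complement R} perf′ max
    stable = originals-stable (proj₁ S′-correct)
    hit = originals-hit perf (λ {K} cK → proj₂ (computeω-correct perf) _ (K , cK , refl)) 1≤ω
      (All.map (λ (cC , eq) → cC , ≤-reflexive (sym eq)) cliques) (proj₁ S′-correct)
      λ {A} sA → ≤-trans (proj₂ (computeω-correct perf′) _ (A , sA , refl))
                         (≤-reflexive (sym (proj₂ S′-correct)))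

  -- The invariant of a run, optimality and termination

  module Invariant {n} (G : Graph n) (perf : Perfect G) where
    private V = vertices G
    open Graph G using (_~_)

    ω : Subset n → ℕ
    ω X = computeω (G on X)

    record Painted (X : Subset n) (c : Coloring n) : Set where
      field
        X⊆V        : X ⊆ V
        uncoloured : ∀ {v} → v ∈ X → c v ≡ nothing
        coloured   : ∀ {v} → v ∈ V → v ∉ X → Is-just (c v)
        proper     : ∀ {u v a} → u ~ v → c u ≡ just a → c v ≢ just a
        -- Each colour is paid for by a drop of ω, so at the end k is at most `ω V`.
        colours    : ∃[ k ] UsesExactly G c k × k + ω X ≤ ω V

    open Painted

    -- The i-th iteration starts with i cliques: the counter is tied to `length 𝒞`, so bounding
    -- chains bounds iterations.
    data Inv : State n → Set₁ where
      outer  : ∀ {X c} → Painted X c → Inv (outer (G on X) c)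
      inner  : ∀ {X 𝒞 c} → Painted X c → 1 ≤ ω X →
        All (λ C → IsClique (G on X) C × ∣ C ∣ ≡ ω X) 𝒞 → Chain 𝒞 → Inv (inner (G on X) 𝒞 (length 𝒞) c)
      halted : ∀ {c} → IsOptimalColoring G c → Inv (halted c)

    painted-initial : Painted V (λ _ → nothing)
    painted-initial = record
      { X⊆V = id
      ; uncoloured = λ _ → refl
      ; coloured = λ v∈V v∉V → ⊥-elim (v∉V v∈V)
      ; proper = λ _ ()
      ; colours = 0 , ([] , [] , refl , λ a → mk⇔ (λ ()) λ ()) , ≤-refl }

    -- An empty S would leave ω unchanged, so the fresh colour is really used: one more colour,
    -- against a drop of ω by at least one.
    painted-exit : ∀ {X c S a} → Painted X c → Stable (G on X) S → ω (X ∩ ∁ S) < ω X →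
      (∀ v → c v ≢ just a) → Painted (X ∩ ∁ S) (paint S a c)
    painted-exit {X} {c} {S} {a} painted (S⊆X , sS) smaller fresh = record
      { X⊆V = X⊆V painted ∘ p∩q⊆p X _
      ; uncoloured = λ v∈ → let v∈X , v∉S = x∈p∩q⁻ X _ v∈ in
          trans (paint-∉ c (x∈∁p⇒x∉p v∉S)) (uncoloured painted v∈X)
      ; coloured = λ {v} v∈V v∉X∖S → case v ∈? S of λ where
          (yes v∈S) → subst Is-just (sym (paint-∈ {a = a} c v∈S)) (MaybeAny.just _)
          (no v∉S)  → subst Is-just (sym (paint-∉ c v∉S))
            (coloured painted v∈V λ v∈X → v∉X∖S (x∈p∩q⁺ (v∈X , x∉p⇒x∈∁p v∉S)))
      ; proper = proper′
      ; colours = let k , (colors , unique , len , uses) , k+ω≤ = colours painted in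
          suc k ,
          (a ∷ colors ,
           All.tabulate (λ {b} b∈ a≡b → let v , _ , cv≡b = to (uses b) b∈ in
             fresh v (trans cv≡b (cong just (sym a≡b)))) ∷ unique ,
           cong suc len ,
           λ b → mk⇔ (λ where
             (here refl) → let v , v∈S = S-nonempty in v , X⊆V painted (S⊆X v∈S) , paint-∈ c v∈S
             (there b∈)  → let v , v∈V , cv≡b = to (uses b) b∈ in
               v , v∈V , trans (paint-∉ c (λ v∈S →
                 case trans (sym cv≡b) (uncoloured painted (S⊆X v∈S)) of λ ())) cv≡b)
             λ (v , v∈V , eq) → case v ∈? S of λ where
               (yes v∈S) → here (Maybe.just-injective (trans (sym eq) (paint-∈ c v∈S)))
               (no v∉S)  → there (from (uses b) (v , v∈V , trans (sym (paint-∉ c v∉S)) eq))) ,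
          ≤-trans (≤-reflexive (sym (+-suc k _))) (≤-trans (+-monoʳ-≤ k smaller) k+ω≤) }
      where
      S-nonempty : Nonempty S
      S-nonempty with nonempty? S
      ... | yes some  = some
      ... | no  empty = ⊥-elim (<-irrefl (cong ω (⊆-antisym (p∩q⊆p X _) λ v∈X →
              x∈p∩q⁺ (v∈X , x∉p⇒x∈∁p λ v∈S → empty (_ , v∈S)))) smaller)
      proper′ : ∀ {u v b} → u ~ v → paint S a c u ≡ just b → paint S a c v ≢ just b
      proper′ {u} {v} u~v with u ∈? S | v ∈? S
      ... | yes u∈S | yes v∈S = λ _ _ → stable⇒≁ {G = G on X} (S⊆X , sS) u∈S v∈S u~v
      ... | yes _   | no  _   = λ where refl → fresh v
      ... | no  _   | yes _   = λ where cu≡a refl → fresh u cu≡a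
      ... | no  _   | no  _   = proper painted u~v

    -- The colour count is at most ω by the invariant, ω equals χ by perfection, and a proper
    -- colouring uses at least χ colours.
    optimal : ∀ {X c} → Painted X c → Empty X → IsOptimalColoring G c
    optimal {X} {c} painted empty =
      isProper , used , subst (IsChromaticNumber G) (sym used≡χG) χG-number , usesExactly
      where
      used = proj₁ (colours painted)
      usesExactly = proj₁ (proj₂ (colours painted))
      isProper : IsProper G c
      isProper = (λ v∈V → coloured painted v∈V λ v∈X → empty (_ , v∈X)) ,
        λ u∈V v∈V u~v cu≡cv → let a , cu≡a = Is-just⇒≡ (coloured painted u∈V λ v∈X → empty (_ , v∈X)) in
          proper painted u~v cu≡a (trans (sym cu≡cv) cu≡a)
      whole = subst (λ Y → ∃[ l ] IsChromaticNumber (G on Y) l × IsCliqueNumber (G on Y) l)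
        (∩-identityʳ V) (perf ⊤)
      χG = proj₁ whole
      χG-number = proj₁ (proj₂ whole)
      χG≡ω = cliqueNumber-unique {G = G} (proj₂ (proj₂ whole)) (computeω-correct perf)
      used≡χG : used ≡ χG
      used≡χG = ≤-antisym
        (≤-trans (≤-trans (m≤m+n used _) (proj₂ (proj₂ (colours painted)))) (≤-reflexive (sym χG≡ω)))
        (proj₂ χG-number used (c , isProper , usesExactly))

    perfect-painted : ∀ {X c} → Painted X c → Perfect (G on X)
    perfect-painted painted = perfect-on {G = G} perf (X⊆V painted)

    preserved : ∀ {s t} → Inv s → s ⟶ t → Inv t
    preserved (outer painted) (finish empty) = halted (optimal painted empty)
    preserved (outer {X} painted) (enter {C = C} (v , v∈X) max) =
      inner painted
        (proj₂ (computeω-correct (perfect-painted painted)) 1 (⁅ v ⁆ , ⁅⁆-clique (G on X) v∈X , ∣⁅x⁆∣≡1 v))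
        (maxClique-correct (perfect-painted painted) max ∷ [])
        -- There are no earlier cliques to meet, so the empty set serves as witness.
        (extend ⊥ [] (trans (cong ∣_∣ (∩-zeroʳ C)) (∣⊥∣≡0 n)) [])
    preserved (inner painted 1≤ω cliques chain) (exit hitting smaller fresh) =
      outer (painted-exit painted
        (proj₁ (hitting-correct (perfect-painted painted) 1≤ω cliques hitting)) smaller fresh)
    preserved (inner {X} {𝒞} {c} painted 1≤ω cliques chain) (continue {S = S} {C′} hitting ¬smaller max) =
      -- C′ misses S, which every collected clique meets, so it is new and `insert` lengthens the
      -- list along with the counter.
      subst (λ 𝒟 → Inv (inner (G on X) 𝒟 (suc (length 𝒞)) c)) (sym (insert-∉ C′∉𝒞))
        (inner painted 1≤ω ((cC′ , ∣C′∣≡ω) ∷ cliques) (extend S hit C′∩S≡0 chain))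
      where
      perfX = perfect-painted painted
      hit = proj₂ (hitting-correct perfX 1≤ω cliques hitting)
      C′-correct = maxClique-correct {G = G on (X ∩ ∁ S)}
        (perfect-on {G = G} perf (X⊆V painted ∘ p∩q⊆p X _)) max
      cC′ : IsClique (G on X) C′
      cC′ = p∩q⊆p X _ ∘ proj₁ (proj₁ C′-correct) , proj₂ (proj₁ C′-correct)
      ∣C′∣≡ω : ∣ C′ ∣ ≡ ω X
      -- As ω did not drop, a maximum clique of the graph without S is still maximum in the graph on
      -- X.
      ∣C′∣≡ω = ≤-antisym (proj₂ (computeω-correct perfX) _ (C′ , cC′ , refl))
        (≤-trans (≮⇒≥ ¬smaller) (≤-reflexive (sym (proj₂ C′-correct))))
      C′∩S≡0 : ∣ C′ ∩ S ∣ ≡ 0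
      C′∩S≡0 = trans (cong ∣_∣ (Empty-unique λ (v , v∈) → let v∈C′ , v∈S = x∈p∩q⁻ C′ S v∈ in
        x∈∁p⇒x∉p (p∩q⊆q X _ (proj₁ (proj₁ C′-correct) v∈C′)) v∈S)) (∣⊥∣≡0 n)
      C′∉𝒞 : C′ List.∉ 𝒞
      C′∉𝒞 C′∈𝒞 = case trans (sym C′∩S≡0) (All.lookup hit C′∈𝒞) of λ ()

    reachable : ∀ {s t} → Inv s → s ⟶* t → Inv t
    reachable inv ε = inv
    reachable inv (step ◅ steps) = reachable (preserved inv step) steps

    inv-initial : Inv (initial G)
    inv-initial = outer painted-initial

    iterations≤∣V∣ : ∀ {H 𝒞 i c} → Inv (inner H 𝒞 i c) → i ≤ ∣ V ∣
    iterations≤∣V∣ (inner {X} {𝒞} painted 1≤ω cliques chain) = chain-length {V = V} 1≤ω cliques-in-V chain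
      where
      weaken : ∀ {C} → IsClique (G on X) C × ∣ C ∣ ≡ ω X → C ⊆ V × ∣ C ∣ ≡ ω X
      weaken ((C⊆X , _) , size) = X⊆V painted ∘ C⊆X , size
      cliques-in-V : All (λ C → C ⊆ V × ∣ C ∣ ≡ ω X) 𝒞
      cliques-in-V = All.map weaken cliques

    -- Every procedure has an output and a fresh colour always exists, so only halted states are
    -- stuck.
    progress : ∀ {s} → Inv s → IsNormalForm _⟶_ s → ∃[ c ] s ≡ halted c × IsOptimalColoring G c
    progress (halted optimal) _ = _ , refl , optimal
    progress (outer {X} {c} _) normal with nonempty? X
    ... | yes some  = ⊥-elim (normal (_ , enter some (proj₂ (maxClique-exists (G on X)))))
    ... | no  empty = ⊥-elim (normal (_ , finish empty))
    progress (inner {X} {𝒞} {c} _ _ _ _) normal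
      with S , hitting ← hittingStableSet-exists (G on X) 𝒞
      with ω (X ∩ ∁ S) <? ω X
    ... | yes smaller = ⊥-elim (normal (_ , exit hitting smaller (proj₂ (fresh-colour c))))
    ... | no ¬smaller = ⊥-elim (normal (_ , continue hitting ¬smaller (proj₂ (maxClique-exists _))))

    -- Lexicographic descent: `k` bounds ω, which falls at each exit, and inside an inner loop `f`
    -- bounds the iterations left, as the counter never passes `∣ V ∣`.
    terminates-outer : ∀ k {X c} → ω X ≤ k → Inv (outer (G on X) c) → Terminates (outer (G on X) c)
    terminates-inner : ∀ k f {X 𝒞 i c} → ω X ≤ k → ∣ V ∣ ≤ f + i →
      Inv (inner (G on X) 𝒞 i c) → Terminates (inner (G on X) 𝒞 i c)
    terminates-outer k ω≤k inv = acc λ where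
      (finish empty)      → acc λ ()
      step@(enter some max) → terminates-inner k ∣ V ∣ ω≤k (m≤m+n _ 1) (preserved inv step)
    terminates-inner k f {X} {𝒞} {i} {c} ω≤k V≤ inv = acc next
      where
      exit-case : ∀ k {S c} → ω (X ∩ ∁ S) < ω X → ω X ≤ k →
        Inv (outer (G on (X ∩ ∁ S)) c) → Terminates (outer (G on (X ∩ ∁ S)) c)
      exit-case zero    smaller ω≤k _ = ⊥-elim (n≮0 (<-≤-trans smaller ω≤k))
      exit-case (suc k) smaller ω≤k   = terminates-outer k (s≤s⁻¹ (<-≤-trans smaller ω≤k))
      continue-case : ∀ f {𝒞 c} → ∣ V ∣ ≤ f + i →
        Inv (inner (G on X) 𝒞 (suc i) c) → Terminates (inner (G on X) 𝒞 (suc i) c)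
      -- Without fuel i is already at least `∣ V ∣`, while the next state would carry `suc i`.
      continue-case zero    V≤ inv′ = ⊥-elim (<-irrefl refl (≤-trans (iterations≤∣V∣ inv′) V≤))
      continue-case (suc f) V≤      = terminates-inner k f ω≤k (≤-trans V≤ (≤-reflexive (sym (+-suc f i))))
      next : ∀ {t} → inner (G on X) 𝒞 i c ⟶ t → Terminates t
      next step@(exit _ smaller _)  = exit-case k smaller ω≤k (preserved inv step)
      next step@(continue _ _ _)    = continue-case f V≤ (preserved inv step)

proposition4 : (O : CliqueOracle) → let open Algorithm O in
    ∀ {n : ℕ} (G : Graph n) → Perfect G →
    (Terminates (initial G) ×
    (∀ {s} → initial G ⟶* s → IsNormalForm _⟶_ s →
    ∃[ c ] s ≡ halted c × IsOptimalColoring G c)) ×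
    (∀ {H 𝒞 i c} → initial G ⟶* inner H 𝒞 i c → i ≤ ∣ vertices G ∣)
proposition4 O G perf =
  (terminates-outer _ ≤-refl inv-initial , λ steps → progress (reachable inv-initial steps)) ,
  λ steps → iterations≤∣V∣ (reachable inv-initial steps)
  where open Correctness.Invariant O G perf
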